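{- For every integer $n\ge 1$, $$|AI_{n}(1234)|=|RAI_{n}(4321)|\quad\text{and}\quad |RAI_{n}(1234)|=|AI_{n}(4321)|.$$
   Context: Let $S_n$ be the set of permutations $\pi=\pi_1\ldots\pi_n$ of $\{1,\ldots,n\}$. A permutation is alternating if, for all $1\le i\le n-1$, $\pi_i<\pi_{i+1}$ if and only if $i$ is odd; it is reverse alternating if, for all $1\le i\le n-1$, $\pi_i>\pi_{i+1}$ if and only if $i$ is odd. $AI_n$ (resp. $RAI_n$) is the set of alternating (resp. reverse alternating) involutions ($\pi=\pi^{ -1}$) in $S_n$. A permutation $\pi\in S_n$ avoids the pattern $\tau\in S_k$ if there are no indices $i_1<\cdots<i_k$ such that $\pi_{i_1}\ldots\pi_{i_k}$ is order-isomorphic to $\tau$; $AI_n(\tau)$ and $RAI_n(\tau)$ are the subsets of elements avoiding $\tau$. -}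

module Defs where

open import Data.Fin.Base using (Fin; toℕ; _<_)
open import Data.Fin.Patterns using (0F; 1F; 2F; 3F)
open import Data.Fin.Properties using (_≟_; _<?_; all?; any?)
open import Data.List.Base using (List; []; _∷_; length; filter; allFin; cartesianProductWith)
open import Data.List.Membership.Propositional using (_∈_; find; lose)
open import Data.List.Membership.Propositional.Properties
  using (∈-allFin; ∈-cartesianProductWith⁺)
open import Data.List.Relation.Unary.All using ([])
open import Data.List.Relation.Unary.AllPairs using ([]; _∷_)
open import Data.List.Relation.Unary.Any using (here)
import Data.List.Relation.Unary.Any as Any
open import Data.List.Relation.Unary.Unique.Propositional using (Unique)
open import Data.List.Relation.Unary.Unique.Propositional.Properties
  using (allFin⁺; cartesianProductWith⁺)
open import Data.Nat.Base using (ℕ; zero; suc; parity)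
import Data.Nat.Properties as ℕ
open import Data.Parity.Base using (1ℙ)
import Data.Parity.Properties as ℙ
open import Data.Product.Base using (_×_; _,_; ∃; proj₁; proj₂)
open import Data.Vec.Base using (Vec; []; _∷_; lookup)
open import Data.Vec.Properties using (∷-injective)
open import Function.Bundles using (_⇔_; mk⇔; Equivalence)
open import Function.Definitions using (Bijective)
open import Level using (0ℓ)
open import Relation.Binary.PropositionalEquality.Core using (_≡_; refl)
open import Relation.Nullary.Decidable using (Dec; map′; _×-dec_; _→-dec_)
open import Relation.Nullary.Negation using (¬_)
open import Relation.Unary using (Pred; Decidable)
open import Relation.Unary.Properties using (∁?)

private
  variable
    k n : ℕ

-- A word w₁ … w_k over {1, …, n}.  Positions and letters are both shifted to
-- start at 0, so `lookup w i` is (w at position toℕ i + 1) − 1.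
Word : ℕ → ℕ → Set
Word n k = Vec (Fin n) k

------------------------------------------------------------------------
-- Cardinality of a decidable set of words

words : ∀ n k → List (Word n k)
words n zero    = [] ∷ []
words n (suc k) = cartesianProductWith _∷_ (allFin n) (words n k)

words-complete : (w : Word n k) → w ∈ words n k
words-complete []      = here refl
words-complete (x ∷ w) = ∈-cartesianProductWith⁺ _∷_ (∈-allFin x) (words-complete w)

words-unique : ∀ n k → Unique (words n k)
words-unique n zero    = [] ∷ []
words-unique n (suc k) =
  cartesianProductWith⁺ _∷_ ∷-injective (allFin⁺ n) (words-unique n k)

-- The number of words satisfying P; by `words-complete` and `words-unique`
-- each of them is counted exactly once.
card : {P : Pred (Word n k) 0ℓ} → Decidable P → ℕ
card {n} {k} P? = length (filter P? (words n k))

------------------------------------------------------------------------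
-- Alternating and reverse alternating involutions

IsPermutation : Pred (Word n n) 0ℓ
IsPermutation π = Bijective _≡_ _≡_ (lookup π)

IsInvolution : Pred (Word n n) 0ℓ
IsInvolution π = ∀ i → lookup π (lookup π i) ≡ i

Odd : Pred ℕ 0ℓ
Odd m = parity m ≡ 1ℙ

-- i and j range over consecutive positions; the `suc` in `Odd (suc (toℕ i))`
-- undoes the shift, so that the first position is odd.
Alternating : Pred (Word n n) 0ℓ
Alternating π = ∀ i j → toℕ j ≡ suc (toℕ i) →
  lookup π i < lookup π j ⇔ Odd (suc (toℕ i))

ReverseAlternating : Pred (Word n n) 0ℓ
ReverseAlternating π = ∀ i j → toℕ j ≡ suc (toℕ i) →
  lookup π j < lookup π i ⇔ Odd (suc (toℕ i))

AI : ∀ n → Pred (Word n n) 0ℓ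
AI n π = IsPermutation π × IsInvolution π × Alternating π

RAI : ∀ n → Pred (Word n n) 0ℓ
RAI n π = IsPermutation π × IsInvolution π × ReverseAlternating π

------------------------------------------------------------------------
-- Pattern avoidance

-- The word ι is the sequence of positions i₁ < ⋯ < i_k of an occurrence of τ.
IsOccurrence : Word k k → Word n n → Pred (Word n k) 0ℓ
IsOccurrence τ π ι =
  (∀ a b → a < b → lookup ι a < lookup ι b) ×
  (∀ a b → lookup τ a < lookup τ b ⇔
           lookup π (lookup ι a) < lookup π (lookup ι b))

Contains : Word k k → Pred (Word n n) 0ℓ
Contains τ π = ∃ (IsOccurrence τ π)

Avoids : Word k k → Pred (Word n n) 0ℓ
Avoids τ π = ¬ Contains τ π

[1234] : Word 4 4
[1234] = 0F ∷ 1F ∷ 2F ∷ 3F ∷ []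

[4321] : Word 4 4
[4321] = 3F ∷ 2F ∷ 1F ∷ 0F ∷ []

------------------------------------------------------------------------
-- Decidability

_⇔-dec_ : {A B : Set} → Dec A → Dec B → Dec (A ⇔ B)
a? ⇔-dec b? = map′ (λ (f , g) → mk⇔ f g) (λ e → Equivalence.to e , Equivalence.from e)
  ((a? →-dec b?) ×-dec (b? →-dec a?))

isPermutation? : Decidable (IsPermutation {n})
isPermutation? π =
  map′ (λ inj {x} {y} → inj x y) (λ inj x y → inj {x} {y})
    (all? λ x → all? λ y → (lookup π x ≟ lookup π y) →-dec (x ≟ y))
  ×-dec
  map′ (λ sur y → proj₁ (sur y) , λ { refl → proj₂ (sur y) })
       (λ sur y → proj₁ (sur y) , proj₂ (sur y) refl)
    (all? λ y → any? λ x → lookup π x ≟ y)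

isInvolution? : Decidable (IsInvolution {n})
isInvolution? π = all? λ i → lookup π (lookup π i) ≟ i

odd? : Decidable Odd
odd? m = parity m ℙ.≟ 1ℙ

alternating? : Decidable (Alternating {n})
alternating? π = all? λ i → all? λ j → (toℕ j ℕ.≟ suc (toℕ i)) →-dec
  ((lookup π i <? lookup π j) ⇔-dec odd? (suc (toℕ i)))

reverseAlternating? : Decidable (ReverseAlternating {n})
reverseAlternating? π = all? λ i → all? λ j → (toℕ j ℕ.≟ suc (toℕ i)) →-dec
  ((lookup π j <? lookup π i) ⇔-dec odd? (suc (toℕ i)))

AI? : ∀ n → Decidable (AI n)
AI? n π = isPermutation? π ×-dec isInvolution? π ×-dec alternating? π

RAI? : ∀ n → Decidable (RAI n)
RAI? n π = isPermutation? π ×-dec isInvolution? π ×-dec reverseAlternating? π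

isOccurrence? : (τ : Word k k) (π : Word n n) → Decidable (IsOccurrence τ π)
isOccurrence? τ π ι =
  (all? λ a → all? λ b → (a <? b) →-dec (lookup ι a <? lookup ι b))
  ×-dec
  (all? λ a → all? λ b → (lookup τ a <? lookup τ b) ⇔-dec
                         (lookup π (lookup ι a) <? lookup π (lookup ι b)))

contains? : (τ : Word k k) → Decidable (Contains {n = n} τ)
contains? {k} {n} τ π =
  map′ (λ p → let (ι , _ , occ) = find p in ι , occ)
       (λ (ι , occ) → lose (words-complete ι) occ)
    (Any.any? (isOccurrence? τ π) (words n k))

avoids? : (τ : Word k k) → Decidable (Avoids {n = n} τ)
avoids? τ = ∁? (contains? τ)

{-# OPTIONS --safe #-}
-- An involution π corresponds to a standard Young tableau, recorded here by the
-- lattice word whose letter j is the row of the entry j.  It is computed with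
-- Fomin's growth diagrams: each point of π creates a box in row 1 and two equal
-- boxes in row k meeting at a cell create one in row k + 1.  The local rules are
-- reversible and symmetric, so that symmetric diagrams, i.e. involutions, are in
-- bijection with lattice words.  The longest increasing subsequence of π has the
-- length of the first row, the longest decreasing one the length of the first
-- column, and π ascends at j exactly when the letters j and j + 1 of the word
-- descend weakly.  Transposing the tableau therefore exchanges the avoidance of
-- 1234 and 4321 and exchanges ascents and descents.
module Submission where

open import Defs
open import Data.Bool.Base using (Bool; true; false; if_then_else_)
open import Data.Empty using (⊥-elim)
open import Data.Fin.Base as Fin using (Fin; toℕ; fromℕ<)
open import Data.Fin.Patterns using (0F; 1F; 2F; 3F)
import Data.Fin.Properties as Fin
open import Data.List.Base as List using (List; length)
open import Data.List.Membership.Propositional using (_∈_)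
open import Data.List.Membership.Propositional.Properties using (∈-filter⁺; ∈-filter⁻; ∈-lookup)
import Data.List.Relation.Unary.All as All
open import Data.List.Relation.Unary.AllPairs using (_∷_)
import Data.List.Relation.Unary.Any as Any
open import Data.List.Relation.Unary.Any.Properties using (lookup-index)
open import Data.List.Relation.Unary.Unique.Propositional using (Unique)
open import Data.List.Relation.Unary.Unique.Propositional.Properties using (filter⁺)
open import Data.Nat.Base
open import Data.Nat.Properties
open import Data.Product.Base using (_×_; _,_; ∃; proj₁; proj₂)
open import Data.Sum.Base using (_⊎_; inj₁; inj₂)
open import Data.Unit.Base using (⊤)
open import Data.Vec.Base using ([]; _∷_; lookup; tabulate)
open import Data.Vec.Properties using (lookup∘tabulate; tabulate∘lookup; tabulate-cong)
open import Function.Base using (_∘_; case_of_)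
open import Function.Bundles using (_⇔_; mk⇔; Equivalence)
open import Level using (0ℓ)
open import Relation.Binary.Definitions using (tri<; tri≈; tri>)
open import Relation.Binary.PropositionalEquality
open import Relation.Nullary using (Dec; yes; no; does; ¬_; contradiction)
open import Relation.Nullary.Decidable using (dec-true; dec-false; from-yes; _×-dec_)
open import Relation.Unary using (Pred; Decidable)
open import Relation.Unary.Properties using (_∩?_)

-- Growth diagrams

-- With letters on the edges, a local rule compares two numbers, and the shape at a corner is
-- recovered by counting letters along the row leading to it. A symmetric diagram carries the same
-- word on its top and right sides, so a single word has to be prescribed when the rules are run
-- backwards. The two length statements differ in nature. The length of the first row obeys a rule
-- that each cell decides by itself. The length of the first column is the largest letter of the top
-- word; it is reached through strictly increasing chains of letters, which have to be followed
-- through all the bumps of a row, once forwards and once backwards. For ascents only two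
-- implications are proved: an ascent of the involution makes the letters descend weakly, a descent
-- makes them rise strictly. These exclude each other, which gives the converses. Cardinalities are
-- compared by injections in both directions, so each involution only needs a partner with the
-- transposed tableau that determines it.

-- Edges of the n × n grid carry letters: 0 when the shapes at the two ends
-- agree, k when they differ by a box in row k.  Here a is the letter below
-- the cell, d the letter on its left, a′ the letter above, d′ the letter on
-- its right, and P says that the cell contains a point of the permutation.
data Cell (P : Set) (a d a′ d′ : ℕ) : Set where
  mark : P → a ≡ 0 → d ≡ 0 → a′ ≡ 1 → d′ ≡ 1 → Cell P a d a′ d′
  pass : ¬ P → (a ≡ d → a ≡ 0) → a′ ≡ a → d′ ≡ d → Cell P a d a′ d′
  bump : ¬ P → 1 ≤ a → d ≡ a → a′ ≡ suc a → d′ ≡ suc a → Cell P a d a′ d′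

Row : (P : ℕ → Set) (n : ℕ) (w d w′ : ℕ → ℕ) → Set
Row P n w d w′ = ∀ j → j < n → Cell (P j) (w j) (d j) (w′ j) (d (suc j))

-- Letter counts, shapes and the lattice condition

δ : ℕ → ℕ → ℕ
δ k a = if k ≡ᵇ a then 1 else 0

δ-same : ∀ k → δ k k ≡ 1
δ-same zero    = refl
δ-same (suc k) = δ-same k

δ-diff : ∀ {k a} → k ≢ a → δ k a ≡ 0
δ-diff {zero}  {zero}  k≢a = contradiction refl k≢a
δ-diff {zero}  {suc a} k≢a = refl
δ-diff {suc k} {zero}  k≢a = refl
δ-diff {suc k} {suc a} k≢a = δ-diff (k≢a ∘ cong suc)

δ≤1 : ∀ k a → δ k a ≤ 1
δ≤1 k a with k ≡ᵇ a
... | true  = ≤-refl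
... | false = z≤n

count : (ℕ → ℕ) → ℕ → ℕ → ℕ
count w zero    k = 0
count w (suc j) k = δ k (w j) + count w j k

count-cong : ∀ {w w′ : ℕ → ℕ} j k → (∀ i → i < j → w i ≡ w′ i) → count w j k ≡ count w′ j k
count-cong zero    k eq = refl
count-cong (suc j) k eq =
  cong₂ _+_ (cong (δ k) (eq j ≤-refl)) (count-cong j k λ i i<j → eq i (m≤n⇒m≤1+n i<j))

count-mono : ∀ w k {i j} → i ≤ j → count w i k ≤ count w j k
count-mono w k = go ∘ ≤⇒≤′
  where
  go : ∀ {i j} → i ≤′ j → count w i k ≤ count w j k
  go (≤′-reflexive refl) = ≤-refl
  go (≤′-step p)         = ≤-trans (go p) (m≤n+m _ _)

count-here : ∀ w j {k} → k ≡ w j → count w (suc j) k ≡ suc (count w j k)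
count-here w j refl = cong (_+ count w j (w j)) (δ-same (w j))

count-there : ∀ w j {k} → k ≢ w j → count w (suc j) k ≡ count w j k
count-there w j k≢ = cong (_+ count w j _) (δ-diff k≢)

count-pos : ∀ w k j → 1 ≤ count w j k → ∃ λ i → i < j × w i ≡ k
count-pos w k (suc j) p with k ≟ w j
... | yes k≡ = j , ≤-refl , sym k≡
... | no  k≢ = let i , i<j , wi≡k = count-pos w k j (subst (1 ≤_) (count-there w j k≢) p)
               in i , m≤n⇒m≤1+n i<j , wi≡k

-- The comparison starts with row 1: the letter 0 stands for an edge without a box, so its count is
-- not part of a shape.
Partition : (ℕ → ℕ) → Set
Partition κ = ∀ k → κ (2 + k) ≤ κ (1 + k)

Lattice : ℕ → (ℕ → ℕ) → Set
Lattice n w = ∀ j → j ≤ n → Partition (count w j)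

partition-antitone : ∀ {κ} → Partition κ → ∀ {k l} → 1 ≤ k → k ≤ l → κ l ≤ κ k
partition-antitone {κ} part {suc k} _ = go ∘ ≤⇒≤′
  where
  go : ∀ {l} → suc k ≤′ l → κ l ≤ κ (suc k)
  go (≤′-reflexive refl)    = ≤-refl
  go (≤′-step {suc l} p) = ≤-trans (part l) (go p)
  go (≤′-step {zero} p) = ⊥-elim (<⇒≱ z<s (≤′⇒≤ p))

cell-conserves : ∀ {P a d a′ d′} k → Cell P a d a′ d′ → δ k a′ + δ k d ≡ δ k a + δ k d′
cell-conserves k (mark _ refl refl refl refl)  = +-comm (δ k 1) (δ k 0)
cell-conserves k (pass _ _ refl refl)          = refl
cell-conserves k (bump _ _ refl refl refl)     = +-comm (δ k (suc _)) _

-- Both ways around a cell add the same boxes, and this telescopes along the row. It holds for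
-- positive `k` only: the letter 0 at the left end adds no box but is counted by `δ 0`.
row-conserves : ∀ {P n w d w′} → Row P n w d w′ → d 0 ≡ 0 → ∀ k → 1 ≤ k → ∀ j → j ≤ n →
                count w′ j k ≡ δ k (d j) + count w j k
row-conserves row d0 (suc k) _ zero    _   rewrite d0 = refl
row-conserves {w = w} {d} {w′} row d0 k 1≤k (suc j) j<n = begin
  δ k (w′ j) + count w′ j k             ≡⟨ cong (δ k (w′ j) +_) (row-conserves row d0 k 1≤k j (<⇒≤ j<n)) ⟩
  δ k (w′ j) + (δ k (d j) + count w j k) ≡⟨ +-assoc (δ k (w′ j)) _ _ ⟨
  (δ k (w′ j) + δ k (d j)) + count w j k ≡⟨ cong (_+ count w j k) (cell-conserves k (row j j<n)) ⟩
  (δ k (w j) + δ k (d (suc j))) + count w j k ≡⟨ cong (_+ count w j k) (+-comm (δ k (w j)) _) ⟩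
  (δ k (d (suc j)) + δ k (w j)) + count w j k ≡⟨ +-assoc (δ k (d (suc j))) _ _ ⟩
  δ k (d (suc j)) + (δ k (w j) + count w j k) ∎
  where open ≡-Reasoning

cell-nonzero : ∀ {P a d a′ d′} → Cell P a d a′ d′ → 1 ≤ a → 1 ≤ a′
cell-nonzero (mark _ refl refl refl refl) 1≤a = ≤-refl
cell-nonzero (pass _ _ refl refl)         1≤a = 1≤a
cell-nonzero (bump _ _ refl refl refl)    1≤a = s≤s z≤n

-- κ, μ, ν and ρ are the shapes at the bottom left, top left, bottom right and top
-- right corners of the cell.
cell-partition : ∀ {P a d a′ d′} {κ μ ν ρ : ℕ → ℕ} → Cell P a d a′ d′ →
  (∀ k → 1 ≤ k → μ k ≡ δ k d + κ k) → (∀ k → ν k ≡ δ k a + κ k) →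
  (∀ k → 1 ≤ k → ρ k ≡ δ k d′ + ν k) → (∀ k → ρ k ≡ δ k a′ + μ k) →
  Partition κ → Partition μ → Partition ν → Partition ρ
cell-partition {a = a} {d} {a′} {d′} {κ} {μ} {ν} {ρ} cell μ≡ ν≡ ρ≡₁ ρ≡₂ pκ pμ pν k = by-cases cell
  where
  open ≤-Reasoning
  -- An inequality of `ρ` is inherited from `ν` or `μ` unless both paths add their last box in row
  -- `2 + k`.
  via-ν : 2 + k ≢ d′ → ρ (2 + k) ≤ ρ (1 + k)
  via-ν ne = begin
    ρ (2 + k)               ≡⟨ ρ≡₁ (2 + k) (s≤s z≤n) ⟩
    δ (2 + k) d′ + ν (2 + k) ≡⟨ cong (_+ ν (2 + k)) (δ-diff ne) ⟩
    ν (2 + k)               ≤⟨ pν k ⟩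
    ν (1 + k)               ≤⟨ m≤n+m _ _ ⟩
    δ (1 + k) d′ + ν (1 + k) ≡⟨ ρ≡₁ (1 + k) (s≤s z≤n) ⟨
    ρ (1 + k)               ∎
  via-μ : 2 + k ≢ a′ → ρ (2 + k) ≤ ρ (1 + k)
  via-μ ne = begin
    ρ (2 + k)               ≡⟨ ρ≡₂ (2 + k) ⟩
    δ (2 + k) a′ + μ (2 + k) ≡⟨ cong (_+ μ (2 + k)) (δ-diff ne) ⟩
    μ (2 + k)               ≤⟨ pμ k ⟩
    μ (1 + k)               ≤⟨ m≤n+m _ _ ⟩
    δ (1 + k) a′ + μ (1 + k) ≡⟨ ρ≡₂ (1 + k) ⟨
    ρ (1 + k)               ∎
  by-cases : Cell _ a d a′ d′ → ρ (2 + k) ≤ ρ (1 + k)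
  by-cases (mark _ _ _ _ d′≡1) = via-ν λ e → case trans e d′≡1 of λ ()
  by-cases (pass _ a≢d a′≡a d′≡d) with 2 + k ≟ d′ | 2 + k ≟ a′
  ... | no ne | _ = via-ν ne
  ... | yes _ | no ne = via-μ ne
  ... | yes refl | yes refl =
    case trans a′≡a (a≢d (trans (sym a′≡a) d′≡d)) of λ ()
  by-cases (bump _ 1≤a d≡a refl refl) with 2 + k ≟ suc a
  ... | no ne = via-ν ne
  -- The new box in row `2 + k` is paid for by the box that row `1 + k` has gained between `κ` and
  -- `ν`.
  ... | yes refl = begin
    ρ (2 + k)                   ≡⟨ ρ≡₂ (2 + k) ⟩
    δ (2 + k) (2 + k) + μ (2 + k) ≡⟨ cong₂ _+_ (δ-same (2 + k)) (μ≡ (2 + k) (s≤s z≤n)) ⟩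
    1 + (δ (2 + k) d + κ (2 + k)) ≡⟨ cong (λ z → 1 + (z + κ (2 + k))) (δ-diff {2 + k} λ e → 1+n≢n (trans e d≡a)) ⟩
    1 + κ (2 + k)               ≤⟨ s≤s (pκ k) ⟩
    1 + κ (1 + k)               ≡⟨ cong (_+ κ (1 + k)) (δ-same (1 + k)) ⟨
    δ (1 + k) (1 + k) + κ (1 + k) ≡⟨ ν≡ (1 + k) ⟨
    ν (1 + k)                   ≤⟨ m≤n+m _ _ ⟩
    δ (1 + k) (2 + k) + ν (1 + k) ≡⟨ ρ≡₁ (1 + k) (s≤s z≤n) ⟨
    ρ (1 + k)                   ∎

row-lattice : ∀ {P n w d w′} → Row P n w d w′ → d 0 ≡ 0 → Lattice n w → Lattice n w′
row-lattice row d0 lat zero    _   k = z≤n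
row-lattice {w = w} {w′ = w′} row d0 lat (suc j) j<n =
  cell-partition (row j j<n)
    (λ k 1≤k → row-conserves row d0 k 1≤k j (<⇒≤ j<n)) (λ k → refl)
    (λ k 1≤k → row-conserves row d0 k 1≤k (suc j) j<n) (λ k → refl)
    (lat j (<⇒≤ j<n)) (row-lattice row d0 lat j (<⇒≤ j<n)) (lat (suc j) j<n)

-- For positive `d`, row `d` of `ρ` ends in a corner; the letter 0 removes nothing.
Removable : (ℕ → ℕ) → ℕ → Set
Removable ρ zero    = ⊤
Removable ρ (suc d) = ρ (2 + d) < ρ (1 + d)

-- Read backwards, the top edge takes a box of row `a′` off `ρ`. In a pass this is not a box of row
-- `d`, so the corner survives; in a bump it lies in the row after `d`, and its removal uncovers a
-- corner of row `d`.
cell-removable : ∀ {P a d a′ d′} {μ ρ : ℕ → ℕ} → Cell P a d a′ d′ →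
  (∀ k → ρ k ≡ δ k a′ + μ k) → Partition ρ → Removable ρ d′ → Removable μ d
cell-removable {d = zero} _ _ _ _ = _
cell-removable {d = suc d} {a′} {d′} {μ} {ρ} (pass _ a≢d refl refl) ρ≡ _ rem = begin-strict
  μ (2 + d)                ≤⟨ m≤n+m _ _ ⟩
  δ (2 + d) a′ + μ (2 + d) ≡⟨ ρ≡ (2 + d) ⟨
  ρ (2 + d)                <⟨ rem ⟩
  ρ (1 + d)                ≡⟨ ρ≡ (1 + d) ⟩
  δ (1 + d) a′ + μ (1 + d) ≡⟨ cong (_+ μ (1 + d)) (δ-diff λ e → case trans e (a≢d (sym e)) of λ ()) ⟩
  μ (1 + d)                ∎
  where open ≤-Reasoning
cell-removable {d = suc d} {μ = μ} {ρ} (bump _ _ refl refl refl) ρ≡ part _ = begin-strict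
  μ (2 + d)                     <⟨ ≤-refl ⟩
  1 + μ (2 + d)                 ≡⟨ cong (_+ μ (2 + d)) (δ-same (2 + d)) ⟨
  δ (2 + d) (2 + d) + μ (2 + d) ≡⟨ ρ≡ (2 + d) ⟨
  ρ (2 + d)                     ≤⟨ part d ⟩
  ρ (1 + d)                     ≡⟨ ρ≡ (1 + d) ⟩
  δ (1 + d) (2 + d) + μ (1 + d) ≡⟨ cong (_+ μ (1 + d)) (δ-diff {1 + d} (1+n≢n ∘ sym)) ⟩
  μ (1 + d)                     ∎
  where open ≤-Reasoning

-- The induction runs from right to left. At column 0 the shape is empty, and there `removable-0`
-- forces the vertical letter to be 0.
row-removable : ∀ {P n w d w′} → Row P n w d w′ → Lattice n w′ →
                Removable (count w′ n) (d n) → ∀ j → j ≤ n → Removable (count w′ j) (d j)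
row-removable {n = n} {d = d} {w′} row lat rem j = go ∘ ≤⇒≤‴
  where
  go : ∀ {j} → j ≤‴ n → Removable (count w′ j) (d j)
  go ≤‴-refl       = rem
  go (≤‴-step j<n) =
    cell-removable (row _ (≤‴⇒≤ j<n)) (λ k → refl) (lat _ (≤‴⇒≤ j<n)) (go j<n)

removable-0 : ∀ {ρ : ℕ → ℕ} → (∀ k → ρ k ≡ 0) → ∀ d → Removable ρ d → d ≡ 0
removable-0 ρ≡0 zero    _   = refl
removable-0 {ρ} ρ≡0 (suc d) rem = ⊥-elim (n≮0 (subst (ρ (2 + d) <_) (ρ≡0 (1 + d)) rem))

-- Going down removes a box of row `d j` from the shape at column `j`. Only the comparison of that
-- row with the next one is at risk, and it is strict because the box is a corner.
row-lattice⁻ : ∀ {P n w d w′} → Row P n w d w′ → d 0 ≡ 0 → Lattice n w′ →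
               Removable (count w′ n) (d n) → Lattice n w
row-lattice⁻ {w = w} {d} {w′} row d0 lat rem j j≤n k =
  by-cases (d j) refl (row-removable row lat rem j j≤n)
  where
  open ≤-Reasoning
  split : ∀ k → count w′ j (suc k) ≡ δ (suc k) (d j) + count w j (suc k)
  split k = row-conserves row d0 (suc k) (s≤s z≤n) j j≤n
  step : count w j (2 + k) ≤ count w′ j (2 + k)
  step = ≤-trans (m≤n+m _ _) (≤-reflexive (sym (split (1 + k))))
  by-cases : ∀ e → d j ≡ e → Removable (count w′ j) e → count w j (2 + k) ≤ count w j (1 + k)
  by-cases e dj≡e r with 1 + k ≟ e
  ... | yes refl = s≤s⁻¹ (begin-strict
    count w j (2 + k)                       ≤⟨ step ⟩
    count w′ j (2 + k)                      <⟨ r ⟩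
    count w′ j (1 + k)                      ≡⟨ split k ⟩
    δ (1 + k) (d j) + count w j (1 + k)     ≤⟨ +-monoˡ-≤ _ (δ≤1 (1 + k) (d j)) ⟩
    1 + count w j (1 + k)                   ∎)
  ... | no ne = begin
    count w j (2 + k)                       ≤⟨ step ⟩
    count w′ j (2 + k)                      ≤⟨ lat j j≤n k ⟩
    count w′ j (1 + k)                      ≡⟨ split k ⟩
    δ (1 + k) (d j) + count w j (1 + k)     ≡⟨ cong (_+ count w j (1 + k)) (δ-diff {1 + k} λ e → ne (trans e dj≡e)) ⟩
    count w j (1 + k)                       ∎

-- Symmetry, determinism and reversibility of the local rules

cell-swap : ∀ {P a d a′ d′} → Cell P a d a′ d′ → Cell P d a d′ a′
cell-swap (mark p a≡ d≡ a′≡ d′≡)            = mark p d≡ a≡ d′≡ a′≡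
cell-swap (pass ¬p a≢d a′≡ d′≡)             = pass ¬p (λ e → trans e (a≢d (sym e))) d′≡ a′≡
cell-swap (bump ¬p 1≤a refl a′≡ d′≡)        = bump ¬p 1≤a refl d′≡ a′≡

cell-deterministic : ∀ {P Q a d a′ d′ b′ e′} → Cell P a d a′ d′ → Cell Q a d b′ e′ →
  (P → Q) → (Q → P) → a′ ≡ b′ × d′ ≡ e′
cell-deterministic (mark _ _ _ refl refl) (mark _ _ _ refl refl) _ _ = refl , refl
cell-deterministic (mark p _ _ _ _) (pass ¬q _ _ _) to _ = contradiction (to p) ¬q
cell-deterministic (mark p _ _ _ _) (bump ¬q _ _ _ _) to _ = contradiction (to p) ¬q
cell-deterministic (pass ¬p _ _ _) (mark q _ _ _ _) _ from = contradiction (from q) ¬p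
cell-deterministic (bump ¬p _ _ _ _) (mark q _ _ _ _) _ from = contradiction (from q) ¬p
cell-deterministic (pass _ _ refl refl) (pass _ _ refl refl) _ _ = refl , refl
cell-deterministic (bump _ _ _ refl refl) (bump _ _ _ refl refl) _ _ = refl , refl
cell-deterministic (pass _ a≢d _ _) (bump _ 1≤a refl _ _) _ _ =
  contradiction (a≢d refl) (>⇒≢ 1≤a)
cell-deterministic (bump _ 1≤a refl _ _) (pass _ a≢d _ _) _ _ =
  contradiction (a≢d refl) (>⇒≢ 1≤a)

-- The outputs tell the rules apart: two letters 1 come from a mark, two equal larger letters from a
-- bump, and all other pairs from a pass.
cell-codeterministic : ∀ {P Q a d b e a′ d′} → Cell P a d a′ d′ → Cell Q b e a′ d′ →
  a ≡ b × d ≡ e × (P → Q)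
cell-codeterministic (mark _ refl refl _ _) (mark q refl refl _ _) = refl , refl , λ _ → q
cell-codeterministic (mark _ _ _ refl refl) (pass _ b≢e refl refl) = case b≢e refl of λ ()
cell-codeterministic (mark _ _ _ refl refl) (bump _ 1≤b _ refl _) = case 1≤b of λ ()
cell-codeterministic (pass ¬p a≢d refl refl) (mark _ _ _ refl refl) = case a≢d refl of λ ()
cell-codeterministic (pass ¬p _ refl refl) (pass _ _ refl refl) = refl , refl , ⊥-elim ∘ ¬p
cell-codeterministic (pass _ a≢d refl refl) (bump _ _ _ refl refl) = case a≢d refl of λ ()
cell-codeterministic (bump _ 1≤a _ refl _) (mark _ _ _ refl _) = case 1≤a of λ ()
cell-codeterministic (bump _ _ _ refl refl) (pass _ b≢e refl refl) = case b≢e refl of λ ()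
cell-codeterministic (bump ¬p _ refl refl _) (bump _ _ refl refl _) = refl , refl , ⊥-elim ∘ ¬p

row-deterministic : ∀ {P Q n w d w′ u e u′} → Row P n w d w′ → Row Q n u e u′ →
  (∀ j → j < n → (P j → Q j) × (Q j → P j)) → (∀ j → j < n → w j ≡ u j) → d 0 ≡ e 0 →
  ∀ j → j < n → w′ j ≡ u′ j
row-deterministic {n = n} {w} {d} {w′} {u} {e} {u′} r s P⇔Q w≡u d≡e j j<n = proj₁ (outputs j j<n)
  where
  outputs : ∀ j → j < n → w′ j ≡ u′ j × d (suc j) ≡ e (suc j)
  left : ∀ j → j < n → d j ≡ e j
  left zero    _   = d≡e
  left (suc j) j<n = proj₂ (outputs j (<⇒≤ j<n))
  outputs j j<n = cell-deterministic (r j j<n)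
    (subst₂ (λ x y → Cell _ x y (u′ j) (e (suc j))) (sym (w≡u j j<n)) (sym (left j j<n)) (s j j<n))
    (proj₁ (P⇔Q j j<n)) (proj₂ (P⇔Q j j<n))

row-codeterministic : ∀ {P Q n w d w′ u e u′} → Row P n w d w′ → Row Q n u e u′ →
  (∀ j → j < n → w′ j ≡ u′ j) → d n ≡ e n → ∀ j → j < n → w j ≡ u j × (P j → Q j)
row-codeterministic {P} {Q} {n} {w} {d} {w′} {u} {e} {u′} r s w′≡u′ d≡e j j<n =
  let w≡u , _ , P⇒Q = inputs j<n (right j<n) in w≡u , P⇒Q
  where
  inputs : ∀ {j} → j < n → d (suc j) ≡ e (suc j) → w j ≡ u j × d j ≡ e j × (P j → Q j)
  inputs {j} j<n eq = cell-codeterministic (r j j<n)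
    (subst₂ (Cell _ (u j) (e j)) (sym (w′≡u′ j j<n)) (sym eq) (s j j<n))
  right : ∀ {j} → j ≤ n → d j ≡ e j
  right = go ∘ ≤⇒≤‴
    where
    go : ∀ {j} → j ≤‴ n → d j ≡ e j
    go ≤‴-refl       = d≡e
    go (≤‴-step j<n) = proj₁ (proj₂ (inputs (≤‴⇒≤ j<n) (go j<n)))

Grid : (P : ℕ → ℕ → Set) (n : ℕ) (h v : ℕ → ℕ → ℕ) → Set
Grid P n h v = ∀ i → i < n → Row (P i) n (h i) (v i) (h (suc i))

grid-codeterministic : ∀ {P Q n h v h′ v′} → Grid P n h v → Grid Q n h′ v′ →
  (∀ j → j < n → h n j ≡ h′ n j) → (∀ i → i < n → v i n ≡ v′ i n) →
  ∀ i j → i < n → j < n → P i j → Q i j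
grid-codeterministic {n = n} {h} {v} {h′} {v′} g g′ top≡ right≡ i j i<n j<n =
  proj₂ (row-codeterministic (g i i<n) (g′ i i<n) (rows i<n) (right≡ i i<n) j j<n)
  where
  rows : ∀ {i} → i ≤ n → ∀ j → j < n → h i j ≡ h′ i j
  rows = go ∘ ≤⇒≤‴
    where
    go : ∀ {i} → i ≤‴ n → ∀ j → j < n → h i j ≡ h′ i j
    go ≤‴-refl = top≡
    go {i} (≤‴-step i<n) j j<n =
      let i<n′ = ≤‴⇒≤ i<n in
      proj₁ (row-codeterministic (g i i<n′) (g′ i i<n′) (go i<n) (right≡ i i<n′) j j<n)

-- The growth diagram of an involution

next : Bool → ℕ → ℕ → ℕ
next true  a       d = 1
next false zero    d = zero
next false (suc a) d = if suc a ≡ᵇ d then 2 + a else suc a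

≡ᵇ-refl : ∀ n → (n ≡ᵇ n) ≡ true
≡ᵇ-refl n = dec-true (n ≟ n) refl

≢⇒≡ᵇ-false : ∀ {m n} → m ≢ n → (m ≡ᵇ n) ≡ false
≢⇒≡ᵇ-false {m} {n} = dec-false (m ≟ n)

next-cell : ∀ {P : Set} (P? : Dec P) a d → (P → a ≡ 0 × d ≡ 0) →
            Cell P a d (next (does P?) a d) (next (does P?) d a)
next-cell (yes p) a d empty = mark p (proj₁ (empty p)) (proj₂ (empty p)) refl refl
next-cell (no ¬p) zero    zero    _ = pass ¬p (λ e → e) refl refl
next-cell (no ¬p) zero    (suc d) _ = pass ¬p (λ ()) refl refl
next-cell (no ¬p) (suc a) zero    _ = pass ¬p (λ ()) refl refl
next-cell (no ¬p) (suc a) (suc d) _ with a ≟ d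
... | yes refl rewrite ≡ᵇ-refl a = bump ¬p (s≤s z≤n) refl refl refl
... | no a≢d rewrite ≢⇒≡ᵇ-false a≢d | ≢⇒≡ᵇ-false (a≢d ∘ sym) =
  pass ¬p (⊥-elim ∘ a≢d ∘ suc-injective) refl refl

-- `hor f i j` lies at height `i` in column `j`, and `ver f i j` in row `i` to the left of column
-- `j`. No side length enters: a square of side `n` is cut out of the diagram of the whole quadrant.
hor ver : (ℕ → ℕ) → ℕ → ℕ → ℕ
hor f zero    j = 0
hor f (suc i) j = next (f i ≡ᵇ j) (hor f i j) (ver f i j)
ver f i zero    = 0
ver f i (suc j) = next (f i ≡ᵇ j) (ver f i j) (hor f i j)

Involutive : (ℕ → ℕ) → Set
Involutive f = ∀ i → f (f i) ≡ i

module _ {f : ℕ → ℕ} (f-inv : Involutive f) where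

  involutive-injective : ∀ {i j} → f i ≡ f j → i ≡ j
  involutive-injective {i} {j} e = trans (sym (f-inv i)) (trans (cong f e) (f-inv j))

  involutive-swap : ∀ {i j} → f i ≡ j → f j ≡ i
  involutive-swap refl = f-inv _

  hor≡ver : ∀ i j → hor f i j ≡ ver f j i
  ver≡hor : ∀ i j → ver f i j ≡ hor f j i
  point-symᵇ : ∀ i j → (f i ≡ᵇ j) ≡ (f j ≡ᵇ i)
  point-symᵇ i j with f i ≟ j
  ... | yes e = trans (dec-true (f i ≟ j) e) (sym (dec-true (f j ≟ i) (involutive-swap e)))
  ... | no ne = trans (dec-false (f i ≟ j) ne) (sym (dec-false (f j ≟ i) (ne ∘ involutive-swap)))
  hor≡ver zero    j = refl
  hor≡ver (suc i) j rewrite point-symᵇ i j | hor≡ver i j | ver≡hor i j = refl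
  ver≡hor i zero    = refl
  ver≡hor i (suc j) rewrite point-symᵇ i j | hor≡ver i j | ver≡hor i j = refl

hor-empty : ∀ f i j → (∀ k → k < i → f k ≢ j) → hor f i j ≡ 0
hor-empty f zero    j _     = refl
hor-empty f (suc i) j empty
  rewrite ≢⇒≡ᵇ-false (empty i ≤-refl)
        | hor-empty f i j (λ k k<i → empty k (m≤n⇒m≤1+n k<i)) = refl

ver-empty : ∀ f i j → (∀ k → k < j → f i ≢ k) → ver f i j ≡ 0
ver-empty f i zero    _     = refl
ver-empty f i (suc j) empty
  rewrite ≢⇒≡ᵇ-false (empty j ≤-refl)
        | ver-empty f i j (λ k k<j → empty k (m≤n⇒m≤1+n k<j)) = refl

module _ {f : ℕ → ℕ} (f-inv : Involutive f) where

  growth-row : ∀ i n → Row (λ j → f i ≡ j) n (hor f i) (ver f i) (hor f (suc i))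
  -- A marked cell must have letters 0 below and to the left: by injectivity neither its column nor
  -- its row contains an earlier point.
  growth-row i n j _ = next-cell (f i ≟ j) (hor f i j) (ver f i j) λ fi≡j →
    hor-empty f i j (λ k k<i fk≡j → <⇒≢ k<i (involutive-injective f-inv (trans fk≡j (sym fi≡j)))) ,
    ver-empty f i j (λ k k<j fi≡k → <⇒≢ k<j (trans (sym fi≡k) fi≡j))

  growth-cell : ∀ i j → Cell (f i ≡ j) (hor f i j) (ver f i j) (hor f (suc i) j) (ver f i (suc j))
  growth-cell i j = growth-row i (suc j) j ≤-refl

  growth-grid : ∀ n → Grid (λ i j → f i ≡ j) n (hor f) (ver f)
  growth-grid n i _ = growth-row i n

  hor-nonzero : ∀ {i j k} → k < i → f k ≡ j → 1 ≤ hor f i j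
  hor-nonzero {suc i} {j} {k} k<1+i fk≡j with m<1+n⇒m<n∨m≡n k<1+i
  ... | inj₁ k<i  = cell-nonzero (growth-cell i j) (hor-nonzero k<i fk≡j)
  ... | inj₂ refl with growth-cell i j
  ...   | mark _ _ _ e _     = ≤-reflexive (sym e)
  ...   | pass ¬p _ _ _      = contradiction fk≡j ¬p
  ...   | bump ¬p _ _ _ _    = contradiction fk≡j ¬p

  hor-lattice : ∀ i n → Lattice n (hor f i)
  hor-lattice zero n j _ k = ≤-reflexive (trans (zero-count j (1 + k)) (sym (zero-count j k)))
    where
    zero-count : ∀ j k → count (hor f 0) j (suc k) ≡ 0
    zero-count zero    k = refl
    zero-count (suc j) k = zero-count j k
  hor-lattice (suc i) n = row-lattice (growth-row i n) refl (hor-lattice i n)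

-- By symmetry equal top words give equal right sides, and the two sides determine all points in the
-- square. The bound on `f` puts the point of row `i` inside it.
growth-injective : ∀ {f g} → Involutive f → Involutive g → ∀ n →
  (∀ i → i < n → f i < n) → (∀ j → j < n → hor f n j ≡ hor g n j) →
  ∀ i → i < n → g i ≡ f i
growth-injective {f} {g} f-inv g-inv n f< top≡ i i<n =
  grid-codeterministic (growth-grid f-inv n) (growth-grid g-inv n) top≡
    (λ k k<n → trans (ver≡hor f-inv k n) (trans (top≡ k k<n) (sym (ver≡hor g-inv k n))))
    i (f i) i<n (f< i i<n) refl

-- Surjectivity of the growth correspondence

-- Undoing a mark and undoing a bump are one operation: equal positive letters both drop by one. The
-- two differ only in whether the common letter was 1.
prev : ℕ → ℕ → ℕ
prev zero    d = zero
prev (suc a) d = if suc a ≡ᵇ d then a else suc a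

prev-cell : ∀ a′ d′ → Cell (a′ ≡ 1 × d′ ≡ 1) (prev a′ d′) (prev d′ a′) a′ d′
prev-cell zero    zero    = pass (λ ()) (λ _ → refl) refl refl
prev-cell zero    (suc d) = pass (λ ()) (λ _ → refl) refl refl
prev-cell (suc a) zero    = pass (λ ()) (λ ()) refl refl
prev-cell (suc a) (suc d) with a ≟ d
prev-cell (suc zero) (suc d) | yes refl = mark (refl , refl) refl refl refl refl
prev-cell (suc (suc a)) (suc d) | yes refl rewrite ≡ᵇ-refl a =
  bump (λ ()) (s≤s z≤n) refl refl refl
... | no a≢d rewrite ≢⇒≡ᵇ-false a≢d | ≢⇒≡ᵇ-false (a≢d ∘ sym) =
  pass (λ { (refl , refl) → a≢d refl }) (⊥-elim ∘ a≢d ∘ suc-injective) refl refl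

revHor revVer : (ℕ → ℕ) → ℕ → ℕ → ℕ
revHor s zero    l = s l
revHor s (suc k) l = prev (revHor s k l) (revVer s k l)
revVer s k zero    = s k
revVer s k (suc l) = prev (revVer s k l) (revHor s k l)

revHor≡revVer : ∀ s k l → revHor s k l ≡ revVer s l k
revVer≡revHor : ∀ s k l → revVer s k l ≡ revHor s l k
revHor≡revVer s zero    l = refl
revHor≡revVer s (suc k) l = cong₂ prev (revHor≡revVer s k l) (revVer≡revHor s k l)
revVer≡revHor s k zero    = refl
revVer≡revHor s k (suc l) = cong₂ prev (revVer≡revHor s k l) (revHor≡revVer s k l)

crossing : ∀ (d : ℕ → ℕ) n → d 0 ≡ 0 → 1 ≤ d n → ∃ λ j → j < n × d j ≡ 0 × 1 ≤ d (suc j)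
crossing d zero    d0 1≤d0 = contradiction d0 (>⇒≢ 1≤d0)
crossing d (suc n) d0 1≤d with d n ≟ 0
... | yes dn≡0 = n , ≤-refl , dn≡0 , 1≤d
... | no  dn≢0 = let j , j<n , p = crossing d n d0 (n≢0⇒n>0 dn≢0) in j , m≤n⇒m≤1+n j<n , p

-- Running the local rules backwards from the word u on the top and right
-- sides of the square; indices are flipped so that the recursion is structural.
module Shrink (n : ℕ) (u : ℕ → ℕ) (u-pos : ∀ j → j < n → 1 ≤ u j) (u-lat : Lattice n u) where

  s : ℕ → ℕ
  s l = u (n ∸ suc l)

  -- An edge lies on one grid line and spans one cell. Counted from the far end, line `i` has number
  -- `n ∸ i` and cell `j` has number `n ∸ suc j`.
  h v : ℕ → ℕ → ℕ
  h i j = revHor s (n ∸ i) (n ∸ suc j)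
  v i j = revVer s (n ∸ suc i) (n ∸ j)

  Point : ℕ → ℕ → Set
  Point i j = h (suc i) j ≡ 1 × v i (suc j) ≡ 1

  ∸-suc-suc : ∀ {i} → i < n → n ∸ i ≡ suc (n ∸ suc i)
  ∸-suc-suc = +-∸-assoc 1

  grid : Grid Point n h v
  grid i i<n j j<n
    rewrite ∸-suc-suc i<n | ∸-suc-suc j<n = prev-cell _ _

  h≡v : ∀ i j → h i j ≡ v j i
  h≡v i j = revHor≡revVer s (n ∸ i) (n ∸ suc j)

  top : ∀ j → j < n → h n j ≡ u j
  top j j<n rewrite n∸n≡0 n | sym (∸-suc-suc j<n) = cong u (m∸[m∸n]≡n (<⇒≤ j<n))

  right : ∀ i → i < n → v i n ≡ u i
  right i i<n = trans (sym (h≡v n i)) (top i i<n)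

  point-swap : ∀ i j → Point i j → Point j i
  point-swap i j (p , q) = trans (h≡v (suc j) i) q , trans (sym (h≡v (suc i) j)) p

  content-removable : ∀ i → i < n → Removable (count u (suc i)) (u i)
  content-removable i i<n = go (u i) refl
    where
    open ≤-Reasoning
    go : ∀ e → u i ≡ e → Removable (count u (suc i)) e
    go zero    _ = _
    go (suc e) ui≡ = begin-strict
      count u (suc i) (2 + e) ≡⟨ count-there u i (λ eq → 1+n≢n (trans eq ui≡)) ⟩
      count u i (2 + e)       ≤⟨ u-lat i (<⇒≤ i<n) e ⟩
      count u i (1 + e)       <⟨ ≤-refl ⟩
      suc (count u i (1 + e)) ≡⟨ cong (suc ∘ count u i) ui≡ ⟨
      suc (count u i (u i))   ≡⟨ count-here u i refl ⟨
      count u (suc i) (u i)   ≡⟨ cong (count u (suc i)) ui≡ ⟩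
      count u (suc i) (1 + e) ∎

  -- The second half identifies the shape at height `i` on the right side with the one reached by
  -- `u` after `i` letters. At height `suc i` this makes the letter `u i` removable, as the next row
  -- down requires.
  Good : ℕ → Set
  Good i = Lattice n (h i) × (∀ k → 1 ≤ k → count (h i) n k ≡ count u i k)

  good-step : ∀ i → i < n → Good (suc i) → v i 0 ≡ 0 × Good i
  good-step i i<n (lat , content) = v0 , row-lattice⁻ (grid i i<n) v0 lat rem , content′
    where
    rem : Removable (count (h (suc i)) n) (v i n)
    rem rewrite right i i<n = go (u i) (content-removable i i<n)
      where
      go : ∀ e → Removable (count u (suc i)) e → Removable (count (h (suc i)) n) e
      go zero    _ = _
      go (suc e) r =
        subst₂ _<_ (sym (content (2 + e) (s≤s z≤n))) (sym (content (1 + e) (s≤s z≤n))) r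
    v0 : v i 0 ≡ 0
    v0 = removable-0 {count (h (suc i)) 0} (λ _ → refl) (v i 0)
           (row-removable (grid i i<n) lat rem 0 z≤n)
    content′ : ∀ k → 1 ≤ k → count (h i) n k ≡ count u i k
    content′ k 1≤k = +-cancelˡ-≡ (δ k (u i)) _ _ (begin
      δ k (u i) + count (h i) n k   ≡⟨ cong (λ z → δ k z + count (h i) n k) (right i i<n) ⟨
      δ k (v i n) + count (h i) n k ≡⟨ row-conserves (grid i i<n) v0 k 1≤k n ≤-refl ⟨
      count (h (suc i)) n k         ≡⟨ content k 1≤k ⟩
      count u (suc i) k             ∎)
      where open ≡-Reasoning

  good : ∀ {i} → i ≤ n → Good i
  good = go ∘ ≤⇒≤‴
    where
    go : ∀ {i} → i ≤‴ n → Good i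
    go ≤‴-refl =
      (λ j j≤n k → subst₂ _≤_ (top-count j≤n (2 + k)) (top-count j≤n (1 + k)) (u-lat j j≤n k)) ,
      λ k _ → sym (top-count ≤-refl k)
      where
      top-count : ∀ {j} → j ≤ n → ∀ k → count u j k ≡ count (h n) j k
      top-count {j} j≤n k = count-cong j k λ i i<j → sym (top i (≤-trans i<j j≤n))
    go {i} (≤‴-step i<n) = proj₂ (good-step i (≤‴⇒≤ i<n) (go i<n))

  left≡0 : ∀ i → i < n → v i 0 ≡ 0
  left≡0 i i<n = proj₁ (good-step i i<n (good i<n))

  bottom≡0 : ∀ j → j < n → h 0 j ≡ 0
  bottom≡0 j j<n = trans (h≡v 0 j) (left≡0 j j<n)

  -- The vertical letter is 0 at the left end of the row and positive at the right end, and only a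
  -- mark turns 0 into a positive letter.
  point : ∀ i → i < n → ∃ λ j → j < n × Point i j
  point i i<n =
    let j , j<n , vj≡0 , 1≤v = crossing (v i) n (left≡0 i i<n) (subst (1 ≤_) (sym (right i i<n)) (u-pos i i<n))
    in j , j<n , from-cell (grid i i<n j j<n) vj≡0 1≤v
    where
    from-cell : ∀ {P a d a′ d′} → Cell P a d a′ d′ → d ≡ 0 → 1 ≤ d′ → P
    from-cell (mark p _ _ _ _)      _    _  = p
    from-cell (pass _ _ _ refl)     refl ()
    from-cell (bump _ () refl _ _) refl _

  ver-nonzero : ∀ i → i < n → ∀ {j k} → 1 ≤ v i j → j ≤ k → k ≤ n → 1 ≤ v i k
  ver-nonzero i i<n {j} 1≤v = go ∘ ≤⇒≤′
    where
    go : ∀ {k} → j ≤′ k → k ≤ n → 1 ≤ v i k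
    go (≤′-reflexive refl) _   = 1≤v
    go (≤′-step j≤k)       k<n =
      cell-nonzero (cell-swap (grid i i<n _ k<n)) (go j≤k (<⇒≤ k<n))

  -- Past a point the vertical letters of the row stay positive, whereas a mark needs the letter 0
  -- on its left.
  point-≮ : ∀ {i j k} → i < n → j < k → k < n → Point i j → ¬ Point i k
  point-≮ {i} {j} {k} i<n j<k k<n (_ , vj≡1) q with grid i i<n k k<n
  ... | mark _ _ vk≡0 _ _ =
    >⇒≢ (ver-nonzero i i<n (≤-reflexive (sym vj≡1)) j<k (<⇒≤ k<n)) vk≡0
  ... | pass ¬q _ _ _   = ¬q q
  ... | bump ¬q _ _ _ _ = ¬q q

  point-unique : ∀ {i j k} → i < n → j < n → k < n → Point i j → Point i k → j ≡ k
  point-unique {i} {j} {k} i<n j<n k<n p q with <-cmp j k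
  ... | tri< j<k _ _ = contradiction q (point-≮ i<n j<k k<n p)
  ... | tri≈ _ j≡k _ = j≡k
  ... | tri> _ _ k<j = contradiction p (point-≮ i<n k<j j<n q)

  f : ℕ → ℕ
  f i with i <? n
  ... | yes i<n = proj₁ (point i i<n)
  ... | no  _   = i

  f-point : ∀ i → i < n → f i < n × Point i (f i)
  f-point i i<n with i <? n
  ... | yes i<n′ = proj₂ (point i i<n′)
  ... | no  i≮n  = contradiction i<n i≮n

  f-outside : ∀ i → i ≮ n → f i ≡ i
  f-outside i i≮n with i <? n
  ... | yes i<n = contradiction i<n i≮n
  ... | no  _   = refl

  f-involutive : Involutive f
  f-involutive i with i <? n
  ... | no i≮n = f-outside i i≮n
  ... | yes i<n =
    let j , j<n , p = point i i<n
        fj<n , q    = f-point j j<n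
    in point-unique j<n fj<n i<n q (point-swap i j p)

  -- Both diagrams have the same points and empty bottom and left sides, so determinism identifies
  -- them row by row.
  hor≡h : ∀ i → i ≤ n → ∀ j → j < n → hor f i j ≡ h i j
  hor≡h zero    _   j j<n = sym (bottom≡0 j j<n)
  hor≡h (suc i) i<n =
    row-deterministic (growth-row f-involutive i n) (grid i i<n)
      (λ j j<n → (λ { refl → proj₂ (f-point i i<n) }) ,
                 (λ p → let fi<n , q = f-point i i<n in point-unique i<n fi<n j<n q p))
      (hor≡h i (<⇒≤ i<n)) (sym (left≡0 i i<n))

growth-surjective : ∀ n u → (∀ j → j < n → 1 ≤ u j) → Lattice n u →
  ∃ λ f → Involutive f × (∀ i → i < n → f i < n) × (∀ j → j < n → hor f n j ≡ u j)
growth-surjective n u u-pos u-lat =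
  f , f-involutive , (λ i i<n → proj₁ (f-point i i<n)) ,
  λ j j<n → trans (hor≡h n ≤-refl j j<n) (top j j<n)
  where open Shrink n u u-pos u-lat

-- Ascents and descents

cell-grows : ∀ {P a d a′ d′} → Cell P a d a′ d′ → a ≤ a′
cell-grows (mark _ refl _ _ _)   = z≤n
cell-grows (pass _ _ refl _)     = ≤-refl
cell-grows (bump _ _ _ refl _)   = n≤1+n _

-- The danger is a raise of the left letter. It is then raised to `d′`, the letter entering the
-- right cell, and a `b` equal to `d′` is bumped as well.
cells-< : ∀ {P Q a d a′ d′ b b′ e} → Cell P a d a′ d′ → Cell Q b d′ b′ e → a < b → a′ < b′
cells-< _ (mark _ refl _ _ _) ()
cells-< (pass _ _ refl _) c₂ a<b = ≤-trans a<b (cell-grows c₂)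
cells-< (mark _ refl _ refl refl) (pass _ b≢1 refl _) 0<b =
  ≤∧≢⇒< 0<b λ 1≡b → case trans 1≡b (b≢1 (sym 1≡b)) of λ ()
cells-< (mark _ _ _ refl refl) (bump _ _ refl refl _) _ = ≤-refl
cells-< (bump _ _ _ refl refl) (pass _ b≢d refl _) a<b =
  ≤∧≢⇒< a<b λ e → case trans e (b≢d (sym e)) of λ ()
cells-< (bump _ _ _ refl refl) (bump _ _ refl refl _) _ = ≤-refl

-- A bump on the right needs `b` equal to `d′`. After a pass on the left, `d′` differs from `a`, so
-- `b` is strictly smaller and has room to grow; after a bump, `d′` already exceeds `a`.
cells-≥ : ∀ {P Q a d a′ d′ b b′ e} → Cell P a d a′ d′ → Cell Q b d′ b′ e →
          (Q → 1 ≤ a) → b ≤ a → b′ ≤ a′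
cells-≥ c₁ (mark q _ _ refl _) 1≤a _ = ≤-trans (1≤a q) (cell-grows c₁)
cells-≥ c₁ (pass _ _ refl _) _ b≤a   = ≤-trans b≤a (cell-grows c₁)
cells-≥ (mark _ refl _ _ _) (bump _ 1≤b _ _ _) _ b≤0 = contradiction (≤-trans 1≤b b≤0) λ ()
cells-≥ (pass _ a≢d refl refl) (bump _ 1≤b refl refl _) _ b≤a =
  ≤∧≢⇒< b≤a λ { refl → >⇒≢ 1≤b (a≢d refl) }
cells-≥ (bump _ _ _ _ refl) (bump _ _ refl _ _) _ b≤a = contradiction b≤a 1+n≰n

module _ {f : ℕ → ℕ} (f-inv : Involutive f) where

  ascent⇒≥ : ∀ j → f j < f (suc j) → ∀ i → hor f i (suc j) ≤ hor f i j
  ascent⇒≥ j lt zero    = z≤n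
  ascent⇒≥ j lt (suc i) =
    cells-≥ (growth-cell {f} f-inv i j) (growth-cell {f} f-inv i (suc j))
      (λ fi≡1+j → hor-nonzero {f} f-inv (subst (f j <_) (involutive-swap {f} f-inv fi≡1+j) lt) (f-inv j))
      (ascent⇒≥ j lt i)

  -- The strict inequality is created in the row holding the point of column `suc j`, when column
  -- `j` is still empty, and `cells-<` carries it upwards.
  descent⇒< : ∀ j → f (suc j) < f j → ∀ i → f (suc j) < i → hor f i j < hor f i (suc j)
  descent⇒< j lt (suc i) lt′ with m<1+n⇒m<n∨m≡n lt′
  ... | inj₁ before =
    cells-< (growth-cell {f} f-inv i j) (growth-cell {f} f-inv i (suc j)) (descent⇒< j lt i before)
  ... | inj₂ now = subst (_< hor f (suc i) (suc j)) (sym none) (hor-nonzero {f} f-inv lt′ (f-inv (suc j)))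
    where
    none : hor f (suc i) j ≡ 0
    none = hor-empty f (suc i) j λ k k≤i fk≡j →
      <⇒≱ lt (≤-trans (≤-reflexive (involutive-swap {f} f-inv fk≡j)) (subst (k ≤_) (sym now) (s≤s⁻¹ k≤i)))

-- Increasing subsequences and the first row

-- The outermost point is the last one; `i` and `j` are the corner whose shape measures these
-- sequences.
data Increasing (f : ℕ → ℕ) : (i j m : ℕ) → Set where
  []  : ∀ {i j} → Increasing f i j 0
  _∷⟨_,_⟩ : ∀ {i j k m} → Increasing f k (f k) m → k < i → f k < j → Increasing f i j (suc m)

increasing-mono : ∀ {f i j i′ j′ m} → i ≤ i′ → j ≤ j′ → Increasing f i j m → Increasing f i′ j′ m
increasing-mono _    _    []                     = []
increasing-mono i≤i′ j≤j′ (c ∷⟨ k<i , fk<j ⟩) = c ∷⟨ ≤-trans k<i i≤i′ , ≤-trans fk<j j≤j′ ⟩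

-- A bump creates its box in row 2 or later, so without a mark the first row at the top right is as
-- long as at one of the two neighbouring corners. Here `z` is its length at the bottom left.
cell-ones : ∀ {P a d a′ d′} z → Cell P a d a′ d′ →
  (δ 1 d′ + (δ 1 a + z) ≡ δ 1 a + z) ⊎ (δ 1 d′ + (δ 1 a + z) ≡ δ 1 d + z) ⊎
  (P × δ 1 d′ + (δ 1 a + z) ≡ suc z)
cell-ones z (mark p refl _ _ refl) = inj₂ (inj₂ (p , refl))
cell-ones {a = a} {d} z (pass _ a≢d _ refl) with 1 ≟ a | 1 ≟ d
... | _ | no 1≢d rewrite δ-diff 1≢d = inj₁ refl
... | no 1≢a | _ rewrite δ-diff 1≢a = inj₂ (inj₁ refl)
... | yes refl | yes refl = case a≢d refl of λ ()
cell-ones z (bump _ (s≤s _) _ _ refl) = inj₁ refl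

module _ {f : ℕ → ℕ} (f-inv : Involutive f) where

  ones : ℕ → ℕ → ℕ
  ones i j = count (hor f i) j 1

  ones-step : ∀ i j → ones (suc i) j ≡ δ 1 (ver f i j) + ones i j
  ones-step i j = row-conserves (growth-row {f} f-inv i j) refl 1 ≤-refl j ≤-refl

  ones-mono : ∀ {i i′ j j′} → i ≤ i′ → j ≤ j′ → ones i j ≤ ones i′ j′
  ones-mono {j = j} {j′} i≤i′ j≤j′ = go (≤⇒≤′ i≤i′)
    where
    go : ∀ {i i′} → i ≤′ i′ → ones i j ≤ ones i′ j′
    go (≤′-reflexive refl) = count-mono _ 1 j≤j′
    go (≤′-step p) = ≤-trans (go p) (≤-trans (m≤n+m _ _) (≤-reflexive (sym (ones-step _ j′))))

  ones-local : ∀ i j →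
    (ones (suc i) (suc j) ≡ ones i (suc j)) ⊎ (ones (suc i) (suc j) ≡ ones (suc i) j) ⊎
    (f i ≡ j × ones (suc i) (suc j) ≡ suc (ones i j))
  ones-local i j rewrite ones-step i (suc j) | ones-step i j =
    cell-ones (ones i j) (growth-cell {f} f-inv i j)

  ones-point : ∀ k → suc (ones k (f k)) ≤ ones (suc k) (suc (f k))
  ones-point k rewrite ones-step k (suc (f k)) with growth-cell {f} f-inv k (f k)
  ... | mark _ _ _ _ d′≡1 rewrite d′≡1 = s≤s (m≤n+m _ _)
  ... | pass ¬p _ _ _   = contradiction refl ¬p
  ... | bump ¬p _ _ _ _ = contradiction refl ¬p

  increasing⇒ones : ∀ {i j m} → Increasing f i j m → m ≤ ones i j
  increasing⇒ones []                  = z≤n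
  increasing⇒ones (c ∷⟨ k<i , fk<j ⟩) =
    ≤-trans (s≤s (increasing⇒ones c)) (≤-trans (ones-point _) (ones-mono k<i fk<j))

  ones⇒increasing : ∀ i j m → m ≤ ones i j → Increasing f i j m
  ones⇒increasing i j zero _ = []
  ones⇒increasing zero (suc j) (suc m) p =
    increasing-mono z≤n (n≤1+n j) (ones⇒increasing zero j (suc m) p)
  ones⇒increasing (suc i) (suc j) (suc m) p with ones-local i j
  ... | inj₁ e = increasing-mono (n≤1+n i) ≤-refl (ones⇒increasing i (suc j) (suc m) (subst (suc m ≤_) e p))
  ... | inj₂ (inj₁ e) = increasing-mono ≤-refl (n≤1+n j) (ones⇒increasing (suc i) j (suc m) (subst (suc m ≤_) e p))
  ... | inj₂ (inj₂ (fi≡j , e)) =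
    subst (λ z → Increasing f i z m) (sym fi≡j)
      (ones⇒increasing i j m (s≤s⁻¹ (subst (suc m ≤_) e p)))
    ∷⟨ ≤-refl , ≤-reflexive (cong suc fi≡j) ⟩

-- Decreasing subsequences and the first column

-- From the outermost point inwards the columns increase, which lines the points up with a chain of
-- letters read from the left.
data Decreasing (f : ℕ → ℕ) : (i p m : ℕ) → Set where
  []      : ∀ {i p} → Decreasing f i p 0
  _∷⟨_,_⟩ : ∀ {i p k m} → Decreasing f k (suc (f k)) m → k < i → p ≤ f k → Decreasing f i p (suc m)

decreasing-mono : ∀ {f i i′ p p′ m} → i ≤ i′ → p′ ≤ p → Decreasing f i p m → Decreasing f i′ p′ m
decreasing-mono _    _    []                     = []
decreasing-mono i≤i′ p′≤p (c ∷⟨ k<i , p≤fk ⟩) = c ∷⟨ ≤-trans k<i i≤i′ , ≤-trans p′≤p p≤fk ⟩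

decreasing-drop : ∀ {f i p m k} → k ≤ m → Decreasing f i p m → Decreasing f i p k
decreasing-drop z≤n       _                  = []
decreasing-drop (s≤s k≤m) (c ∷⟨ k<i , q ⟩) = decreasing-drop k≤m c ∷⟨ k<i , q ⟩

-- Strictly increasing letters above c, read from the left: the form suited to
-- following a bump to the right.
data RisingFrom (w : ℕ → ℕ) : (r p c m : ℕ) → Set where
  done : ∀ {r p c} → RisingFrom w r p c 0
  skip : ∀ {r p c m} → RisingFrom w r (suc p) c m → RisingFrom w (suc r) p c m
  take : ∀ {r p c m} → c < w p → RisingFrom w r (suc p) (w p) m → RisingFrom w (suc r) p c (suc m)

risingFrom-weaken : ∀ {w r p c c′ m} → c′ ≤ c → RisingFrom w r p c m → RisingFrom w r p c′ m
risingFrom-weaken _    done       = done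
risingFrom-weaken c′≤c (skip s)   = skip (risingFrom-weaken c′≤c s)
risingFrom-weaken c′≤c (take l s) = take (≤-<-trans c′≤c l) s

risingFrom-tail : ∀ {w r p c m} → RisingFrom w r p c (suc m) → RisingFrom w r p (suc c) m
risingFrom-tail (skip s)   = skip (risingFrom-tail s)
risingFrom-tail (take l s) = skip (risingFrom-weaken l s)

risingFrom-letter : ∀ {w r p c m} → RisingFrom w r p c (suc m) → ∃ λ j → j < p + r × c + suc m ≤ w j
risingFrom-letter {w} {suc r} {p} (skip s) =
  let j , j< , l = risingFrom-letter s in j , subst (j <_) (sym (+-suc p r)) j< , l
risingFrom-letter {w} {suc r} {p} {c} (take {m = zero} l _) =
  p , m<m+n p z<s , subst (_≤ w p) (sym (+-comm c 1)) l
risingFrom-letter {w} {suc r} {p} {c} (take {m = suc m} l s) =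
  let j , j< , l′ = risingFrom-letter s in
  j , subst (j <_) (sym (+-suc p r)) j< ,
  ≤-trans (subst (_≤ w p + suc m) (sym (+-suc c (suc m))) (+-monoˡ-≤ (suc m) l)) l′

module _ {P : ℕ → Set} {w d w′ : ℕ → ℕ}
         (cell : ∀ j → Cell (P j) (w j) (d j) (w′ j) (d (suc j))) where

  risingFrom-step : ∀ r {p c m} → RisingFrom w r p c m → RisingFrom w′ r p c m
  -- The vertical letter `suc c` makes up for the higher bound. A chosen letter equal to it is
  -- bumped above the bound; an unchosen one becomes `2 + c` and replaces the first letter of the
  -- chain.
  risingFrom-bump : ∀ r {p c m} → d p ≡ suc c → RisingFrom w r p c m → RisingFrom w′ r p (suc c) m

  risingFrom-step r       done     = done
  risingFrom-step (suc r) (skip s) = skip (risingFrom-step r s)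
  risingFrom-step (suc r) {p} {c} (take l s) with cell p
  ... | mark _ w≡0 _ _ _      = contradiction (subst (c <_) w≡0 l) n≮0
  ... | pass _ _ w′≡w _       =
    take (subst (c <_) (sym w′≡w) l) (subst (λ z → RisingFrom w′ r _ z _) (sym w′≡w) (risingFrom-step r s))
  ... | bump _ _ _ w′≡ d′≡    =
    take (subst (c <_) (sym w′≡) (m≤n⇒m≤1+n l))
         (subst (λ z → RisingFrom w′ r _ z _) (sym w′≡) (risingFrom-bump r d′≡ s))

  risingFrom-bump r       _  done = done
  risingFrom-bump (suc r) {p} {c} dp≡ (skip {m = m} s) with cell p
  ... | mark _ _ d≡0 _ _   = case trans (sym dp≡) d≡0 of λ ()
  ... | pass _ _ _ d′≡d    = skip (risingFrom-bump r (trans d′≡d dp≡) s)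
  risingFrom-bump (suc r) {p} {c} {zero}  dp≡ (skip s) | bump _ _ _ _ _ = done
  risingFrom-bump (suc r) {p} {c} {suc m} dp≡ (skip s) | bump _ _ d≡a w′≡ d′≡ =
    take (subst (suc c <_) (sym w′≡2+c) ≤-refl)
         (subst (λ z → RisingFrom w′ r _ z _) (sym w′≡2+c)
                (risingFrom-bump r (trans d′≡ (cong suc a≡1+c)) (risingFrom-tail s)))
    where
    a≡1+c : w p ≡ suc c
    a≡1+c = trans (sym d≡a) dp≡
    w′≡2+c : w′ p ≡ 2 + c
    w′≡2+c = trans w′≡ (cong suc a≡1+c)
  risingFrom-bump (suc r) {p} {c} dp≡ (take l s) with cell p
  ... | mark _ _ d≡0 _ _   = case trans (sym dp≡) d≡0 of λ ()
  ... | pass _ a≢d w′≡w _  =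
    take (subst (suc c <_) (sym w′≡w) (≤∧≢⇒< l λ e → m<n⇒n≢0 l (a≢d (trans (sym e) (sym dp≡)))))
         (subst (λ z → RisingFrom w′ r _ z _) (sym w′≡w) (risingFrom-step r s))
  ... | bump _ _ d≡a w′≡ d′≡ =
    take (subst (suc c <_) (sym w′≡) (s≤s l))
         (subst (λ z → RisingFrom w′ r _ z _) (sym w′≡) (risingFrom-bump r d′≡ s))

-- Strictly increasing letters between 1 and e − 1, read from the right: the form
-- suited to undoing a bump.
data RisingTo (w : ℕ → ℕ) (p : ℕ) : (q e m : ℕ) → Set where
  done : ∀ {q e} → RisingTo w p q e 0
  skip : ∀ {q e m} → RisingTo w p q e m → RisingTo w p (suc q) e m
  take : ∀ {q e m} → p ≤ q → 1 ≤ w q → w q < e → RisingTo w p q (w q) m →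
         RisingTo w p (suc q) e (suc m)

risingTo-init : ∀ {w p q e m} → RisingTo w p q (suc e) (suc m) → p < q × RisingTo w p q e m
risingTo-init (skip c)          = let p<q , c′ = risingTo-init c in m≤n⇒m≤1+n p<q , skip c′
risingTo-init (take p≤q _ l c) = s≤s p≤q , skip (weaken (s≤s⁻¹ l) c)
  where
  weaken : ∀ {w p q e e′ m} → e ≤ e′ → RisingTo w p q e m → RisingTo w p q e′ m
  weaken e≤e′ done              = done
  weaken e≤e′ (skip c)          = skip (weaken e≤e′ c)
  weaken e≤e′ (take p≤q l l′ c) = take p≤q l (<-≤-trans l′ e≤e′) c

risingTo-≤ : ∀ {w p q q′ e m} → q ≤ q′ → RisingTo w p q e m → RisingTo w p q′ e m
risingTo-≤ {w} {p} {q} {e = e} {m} = go ∘ ≤⇒≤′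
  where
  go : ∀ {q′} → q ≤′ q′ → RisingTo w p q e m → RisingTo w p q′ e m
  go (≤′-reflexive refl) c = c
  go (≤′-step q≤q′)      c = skip (go q≤q′ c)

risingTo-cong : ∀ {w w′ p q e m} → (∀ j → j < q → w j ≡ w′ j) →
               RisingTo w p q e m → RisingTo w′ p q e m
risingTo-cong eq done = done
risingTo-cong eq (skip c) = skip (risingTo-cong (λ j j<q → eq j (m≤n⇒m≤1+n j<q)) c)
risingTo-cong {w′ = w′} {p} eq (take {q} p≤q l l′ c) =
  take p≤q (subst (1 ≤_) q≡ l) (subst (_< _) q≡ l′)
       (subst (λ z → RisingTo w′ p q z _) q≡ (risingTo-cong (λ j j<q → eq j (m≤n⇒m≤1+n j<q)) c))
  where q≡ = eq q ≤-refl

risingTo-1 : ∀ {w p q m} → ¬ RisingTo w p q 1 (suc m)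
risingTo-1 (skip c)       = risingTo-1 c
risingTo-1 (take _ l l′ _) = <⇒≱ l′ l

module _ {P : ℕ → Set} {w d w′ : ℕ → ℕ}
         (cell : ∀ j → Cell (P j) (w j) (d j) (w′ j) (d (suc j)))
         (j : ℕ) (Pj : P j) (P-unique : ∀ k → P k → k ≡ j)
         (before : ∀ k → k < j → w′ k ≡ w k) where

  -- A chain of m letters of the new row comes from a chain of m letters of the
  -- old row or, when it starts with the point in column j, of m − 1 letters to
  -- the right of that column.
  data Origin (p q e : ℕ) : ℕ → Set where
    old : ∀ {m} → RisingTo w p q e m → Origin p q e m
    new : ∀ {m} → p ≤ j → RisingTo w (suc j) q e m → Origin p q e (suc m)

  origin-skip : ∀ {p q e m} → Origin p q e m → Origin p (suc q) e m
  origin-skip (old c)   = old (skip c)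
  origin-skip (new l c) = new l (skip c)

  origin-take : ∀ {p q e m} → j < q → p ≤ q → 1 ≤ w q → w q < e → Origin p q (w q) m →
                Origin p (suc q) e (suc m)
  origin-take j<q p≤q l l′ (old c)    = old (take p≤q l l′ c)
  origin-take j<q p≤q l l′ (new l₂ c) = new l₂ (take j<q l l′ c)

  at-mark : w′ j ≡ 1 × d (suc j) ≡ 1
  at-mark with cell j
  ... | mark _ _ _ w′≡1 d′≡1  = w′≡1 , d′≡1
  ... | pass ¬p _ _ _         = contradiction Pj ¬p
  ... | bump ¬p _ _ _ _       = contradiction Pj ¬p

  origin-before : ∀ {p q e m} → q ≤ j → RisingTo w′ p q e m → RisingTo w p q e m
  origin-before q≤j = risingTo-cong λ k k<q → before k (≤-trans k<q q≤j)

  origin-mark : ∀ {p e m} → RisingTo w′ p (suc j) e m → Origin p (suc j) e m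
  origin-mark done                         = old done
  origin-mark (skip c)                     = old (skip (origin-before ≤-refl c))
  -- The point writes the letter 1, below which no chain continues to the left.
  origin-mark (take {m = zero} p≤j _ _ _)  = new p≤j done
  origin-mark {p} (take {m = suc m} _ _ _ c) =
    ⊥-elim (risingTo-1 (subst (λ z → RisingTo w′ p j z (suc m)) (proj₁ at-mark) c))

  origin-bump-mark : ∀ {p m} → RisingTo w′ p (suc j) 2 m → Origin p (suc j) 1 m
  origin-bump-mark {m = zero}        _ = old done
  origin-bump-mark {m = suc zero}    c = new (s≤s⁻¹ (proj₁ (risingTo-init c))) done
  origin-bump-mark {m = suc (suc m)} c = ⊥-elim (risingTo-1 (proj₂ (risingTo-init c)))

  origin      : ∀ {q p e m} → j <′ q → RisingTo w′ p q e m → Origin p q e m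
  -- This is `risingFrom-bump` read leftwards. The old letter of a bumped column is one below the
  -- vertical letter leaving it, hence fits under the lowered bound; if that column was not chosen,
  -- its letter replaces the rightmost one of the chain.
  origin-bump : ∀ {q p m} → j <′ q → RisingTo w′ p q (suc (d q)) m → Origin p q (d q) m

  origin (≤′-reflexive refl) c = origin-mark c
  origin (≤′-step j<q) done     = old done
  origin (≤′-step j<q) (skip c) = origin-skip (origin j<q c)
  origin {p = p} (≤′-step {q} j<q) (take {e = e} {m} p≤q 1≤w′ w′<e c) with cell q
  ... | mark Pq _ _ _ _ = contradiction (P-unique q Pq) (>⇒≢ (≤′⇒≤ j<q))
  ... | pass _ _ w′≡w _ =
    origin-take (≤′⇒≤ j<q) p≤q (subst (1 ≤_) w′≡w 1≤w′) (subst (_< e) w′≡w w′<e)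
      (origin j<q (subst (λ z → RisingTo w′ p q z m) w′≡w c))
  ... | bump _ 1≤a d≡a w′≡ _ =
    origin-take (≤′⇒≤ j<q) p≤q 1≤a (<-trans (n<1+n _) (subst (_< e) w′≡ w′<e))
      (subst (λ z → Origin p q z m) d≡a
        (origin-bump j<q (subst (λ z → RisingTo w′ p q z m) (trans w′≡ (cong suc (sym d≡a))) c)))

  origin-bump {p = p} {m} (≤′-reflexive refl) c =
    subst (λ z → Origin p (suc j) z m) (sym (proj₂ at-mark))
      (origin-bump-mark (subst (λ z → RisingTo w′ p (suc j) (suc z) m) (proj₂ at-mark) c))
  origin-bump (≤′-step j<q) done = old done
  origin-bump {p = p} {m} (≤′-step {q} j<q) (skip c) with cell q
  ... | mark Pq _ _ _ _ = contradiction (P-unique q Pq) (>⇒≢ (≤′⇒≤ j<q))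
  ... | pass _ _ _ d′≡d =
    origin-skip (subst (λ z → Origin p q z m) (sym d′≡d)
      (origin-bump j<q (subst (λ z → RisingTo w′ p q (suc z) m) d′≡d c)))
  origin-bump {m = zero} (≤′-step j<q) (skip c) | bump _ _ _ _ _ = old done
  origin-bump {p = p} {suc m} (≤′-step {q} j<q) (skip c) | bump _ 1≤a d≡a _ d′≡ =
    let p<q , c′ = risingTo-init c in
    origin-take (≤′⇒≤ j<q) (<⇒≤ p<q) 1≤a (≤-reflexive (sym d′≡))
      (subst (λ z → Origin p q z m) d≡a
        (origin-bump j<q (subst (λ z → RisingTo w′ p q z m) (trans d′≡ (cong suc (sym d≡a))) c′)))
  origin-bump {p = p} (≤′-step {q} j<q) (take {m = m} p≤q 1≤w′ w′≤d′ c) with cell q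
  ... | mark Pq _ _ _ _ = contradiction (P-unique q Pq) (>⇒≢ (≤′⇒≤ j<q))
  ... | pass _ a≢d w′≡w d′≡d =
    origin-take (≤′⇒≤ j<q) p≤q 1≤w
      (≤∧≢⇒< (s≤s⁻¹ (subst (_< _) w′≡w w′≤d′)) λ w≡d′ → >⇒≢ 1≤w (a≢d (trans w≡d′ d′≡d)))
      (origin j<q (subst (λ z → RisingTo w′ p q z m) w′≡w c))
    where
    1≤w : 1 ≤ w q
    1≤w = subst (1 ≤_) w′≡w 1≤w′
  ... | bump _ 1≤a d≡a w′≡ d′≡ =
    origin-take (≤′⇒≤ j<q) p≤q 1≤a (≤-reflexive (sym d′≡))
      (subst (λ z → Origin p q z m) d≡a
        (origin-bump j<q (subst (λ z → RisingTo w′ p q z m) (trans w′≡ (cong suc (sym d≡a))) c)))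

module _ {f : ℕ → ℕ} (f-inv : Involutive f) where

  risingFrom-mono : ∀ {i i′ r p c m} → i ≤ i′ → RisingFrom (hor f i) r p c m → RisingFrom (hor f i′) r p c m
  risingFrom-mono {i} {r = r} {p} {c} {m} = go ∘ ≤⇒≤′
    where
    go : ∀ {i′} → i ≤′ i′ → RisingFrom (hor f i) r p c m → RisingFrom (hor f i′) r p c m
    go (≤′-reflexive refl) s = s
    go (≤′-step q)         s = risingFrom-step (growth-cell {f} f-inv _) r (go q s)

  risingFrom-more : ∀ {w p c m} k {r} → RisingFrom w r (k + p) c m → RisingFrom w (k + r) p c m
  risingFrom-more zero s = s
  risingFrom-more {w} {p} {c} {m} (suc k) {r} s =
    skip (risingFrom-more k (subst (λ z → RisingFrom w r z c m) (sym (+-suc k p)) s))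

  -- The latest point writes a 1 in its column and sends a vertical 1 to the right. That lifts the
  -- chain of the earlier points above 1, so the new letter can be put in front.
  decreasing⇒risingFrom : ∀ {n i p m} → (∀ k → k < n → f k < n) → i ≤ n → p ≤ n →
    Decreasing f i p m → RisingFrom (hor f i) (n ∸ p) p 0 m
  decreasing⇒risingFrom _ _ _ [] = done
  decreasing⇒risingFrom {n} {i} {p} f< i≤n p≤n (_∷⟨_,_⟩ {k = k} {m} c k<i p≤fk) =
    risingFrom-mono k<i (subst (λ z → RisingFrom (hor f (suc k)) z p 0 (suc m)) length≡
      (risingFrom-more (f k ∸ p) (subst (λ z → RisingFrom (hor f (suc k)) (n ∸ f k) z 0 (suc m))
        (sym (m∸n+n≡m p≤fk)) inserted)))
    where
    fk<n : f k < n
    fk<n = f< k (≤-trans k<i i≤n)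
    length≡ : (f k ∸ p) + (n ∸ f k) ≡ n ∸ p
    length≡ = trans (sym (+-∸-comm (n ∸ f k) p≤fk)) (cong (_∸ p) (m+[n∸m]≡n (<⇒≤ fk<n)))
    inserted : RisingFrom (hor f (suc k)) (n ∸ f k) (f k) 0 (suc m)
    inserted rewrite +-∸-assoc 1 fk<n with growth-cell {f} f-inv k (f k)
    ... | mark _ _ _ a′≡1 d′≡1 =
      take (≤-reflexive (sym a′≡1)) (subst (λ z → RisingFrom (hor f (suc k)) (n ∸ suc (f k)) (suc (f k)) z m)
        (sym a′≡1) (risingFrom-bump (growth-cell {f} f-inv k) (n ∸ suc (f k)) d′≡1
          (decreasing⇒risingFrom f< (<⇒≤ (≤-trans k<i i≤n)) fk<n c)))
    ... | pass ¬p _ _ _   = contradiction refl ¬p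
    ... | bump ¬p _ _ _ _ = contradiction refl ¬p

  before-point : ∀ i k → k < f i → hor f (suc i) k ≡ hor f i k
  before-point i k k<fi with growth-cell {f} f-inv i k
  ... | mark fi≡k _ _ _ _ = contradiction (sym fi≡k) (<⇒≢ k<fi)
  ... | pass _ _ e _      = e
  ... | bump _ 1≤a d≡a _ _ =
    contradiction (trans (sym d≡a) (ver-empty f i k λ l l<k fi≡l →
      <-asym l<k (subst (k <_) fi≡l k<fi))) (>⇒≢ 1≤a)

  risingTo⇒decreasing : ∀ i {p q e m} → RisingTo (hor f i) p q e m → Decreasing f i p m
  risingTo⇒decreasing zero done           = []
  risingTo⇒decreasing zero (skip c)       = risingTo⇒decreasing zero c
  risingTo⇒decreasing zero (take _ () _ _)
  risingTo⇒decreasing (suc i) {p} {q} c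
    -- The range of the chain is first enlarged beyond column `f i`, as `origin` scans back to the
    -- point from its right.
    with origin (growth-cell {f} f-inv i) (f i) refl (λ k → sym) (before-point i)
           (≤⇒≤′ (m≤n+m (suc (f i)) q)) (risingTo-≤ (m≤m+n q (suc (f i))) c)
  ... | old c′   = decreasing-mono (n≤1+n i) ≤-refl (risingTo⇒decreasing i c′)
  ... | new l c′ = risingTo⇒decreasing i c′ ∷⟨ ≤-refl , l ⟩

-- In a lattice word every letter above 1 is preceded by the letter one smaller; following these
-- back to 1 gives the chain.
lattice⇒risingTo : ∀ {u n} → Lattice n u → ∀ k j → j < n → u j ≡ suc k →
                  RisingTo u 0 (suc j) (2 + k) (suc k)
lattice⇒risingTo {u} lat zero j j<n uj≡ =
  take z≤n (≤-reflexive (sym uj≡)) (subst (_< 2) (sym uj≡) ≤-refl) done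
lattice⇒risingTo {u} {n} lat (suc k) j j<n uj≡ =
  let i , i<j , ui≡ = count-pos u (suc k) j earlier in
  take z≤n (subst (1 ≤_) (sym uj≡) (s≤s z≤n)) (≤-reflexive (cong suc uj≡))
    (subst (λ z → RisingTo u 0 j z (suc k)) (sym uj≡)
      (risingTo-≤ i<j (lattice⇒risingTo lat k i (<-trans i<j j<n) ui≡)))
  where
  open ≤-Reasoning
  earlier : 1 ≤ count u j (suc k)
  earlier = begin
    1                         ≤⟨ s≤s z≤n ⟩
    suc (count u j (u j))     ≡⟨ count-here u j refl ⟨
    count u (suc j) (u j)     ≡⟨ cong (count u (suc j)) uj≡ ⟩
    count u (suc j) (2 + k)   ≤⟨ lat (suc j) j<n k ⟩
    count u (suc j) (1 + k)   ≡⟨ count-there u j (λ e → 1+n≢n (sym (trans e uj≡))) ⟩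
    count u j (1 + k)         ∎

-- Transposition of tableaux

-- Letter j of the transposed word is the column of the box added at step j.
transpose : (ℕ → ℕ) → ℕ → ℕ
transpose u j = suc (count u j (u j))

transpose-cong : ∀ {n} {u w : ℕ → ℕ} → (∀ j → j < n → u j ≡ w j) →
                 ∀ j → j < n → transpose u j ≡ transpose w j
transpose-cong {u = u} {w} eq j j<n = cong suc (begin
  count u j (u j) ≡⟨ cong (count u j) (eq j j<n) ⟩
  count u j (w j) ≡⟨ count-cong j (w j) (λ i i<j → eq i (<-trans i<j j<n)) ⟩
  count w j (w j) ∎)
  where open ≡-Reasoning

count-last : ∀ w k n m → suc m ≤ count w n k → ∃ λ j → j < n × w j ≡ k × m ≤ count w j k
count-last w k (suc n) m p with k ≟ w n
... | yes refl = n , ≤-refl , refl , s≤s⁻¹ (subst (suc m ≤_) (count-here w n refl) p)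
... | no k≢ =
  let j , j<n , q = count-last w k n m (subst (suc m ≤_) (count-there w n k≢) p)
  in j , m≤n⇒m≤1+n j<n , q

module _ {n : ℕ} {u : ℕ → ℕ} (u-pos : ∀ j → j < n → 1 ≤ u j) (u-lat : Lattice n u) where

  private
    uᵗ : ℕ → ℕ
    uᵗ = transpose u

  Conjugate : ℕ → Set
  Conjugate j = ∀ k l → suc k ≤ count uᵗ j (suc l) ⇔ suc l ≤ count u j (suc k)

  -- Before step `j`, column `uᵗ j` lacks its box in row `u j` but, by the lattice condition, has
  -- the one just above. So its length is one less than `u j`.
  row-of-box : ∀ j → j < n → Conjugate j → suc (count uᵗ j (uᵗ j)) ≡ u j
  row-of-box j j<n conj = go (u j) refl (u-pos j j<n)
    where
    open ≤-Reasoning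
    go : ∀ a → u j ≡ a → 1 ≤ a → suc (count uᵗ j (uᵗ j)) ≡ a
    go (suc a) uj≡ _ = ≤-antisym
      (≰⇒> λ p → 1+n≰n (subst (λ z → uᵗ j ≤ count u j z) (sym uj≡) (Equivalence.to (conj a _) p)))
      (s≤s (lower a uj≡))
      where
      lower : ∀ a → u j ≡ suc a → a ≤ count uᵗ j (uᵗ j)
      lower zero    _   = z≤n
      lower (suc a) uj≡ = Equivalence.from (conj a _) (begin
        suc (count u j (u j))   ≡⟨ count-here u j refl ⟨
        count u (suc j) (u j)   ≡⟨ cong (count u (suc j)) uj≡ ⟩
        count u (suc j) (2 + a) ≤⟨ u-lat (suc j) j<n a ⟩
        count u (suc j) (1 + a) ≡⟨ count-there u j (λ e → 1+n≢n (sym (trans e uj≡))) ⟩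
        count u j (1 + a)       ∎)

  conjugate : ∀ j → j ≤ n → Conjugate j
  conjugate zero    _   k l = mk⇔ (λ ()) (λ ())
  -- Step `j` adds the box in row `u j` and column `uᵗ j`. When just one of the two indices agrees,
  -- a count grows without reaching the box in question.
  conjugate (suc j) j<n k l with suc l ≟ uᵗ j | suc k ≟ u j
  ... | no l≢ | no k≢
    rewrite count-there uᵗ j l≢ | count-there u j k≢ = conjugate j (<⇒≤ j<n) k l
  ... | no l≢ | yes k≡
    rewrite count-there uᵗ j l≢ | count-here u j k≡ =
      mk⇔ (λ p → m≤n⇒m≤1+n (to p)) (λ q → from (s≤s⁻¹ (≤∧≢⇒< q λ e → l≢ (trans e (cong (suc ∘ count u j) k≡)))))
    where open Equivalence (conjugate j (<⇒≤ j<n) k l)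
  ... | yes refl | no k≢
    rewrite count-here uᵗ j refl | count-there u j k≢ | row-of-box j j<n (conjugate j (<⇒≤ j<n)) =
      mk⇔ (λ p → to (s≤s⁻¹ (≤-trans (≤∧≢⇒< p k≢) (≤-reflexive (sym row)))))
          (λ q → ≤-trans (m≤n⇒m≤1+n (from q)) (≤-reflexive row))
    where
    open Equivalence (conjugate j (<⇒≤ j<n) k l)
    row = row-of-box j j<n (conjugate j (<⇒≤ j<n))
  ... | yes refl | yes k≡ = mk⇔
    (λ _ → ≤-reflexive (sym (trans (cong (count u (suc j)) k≡) (count-here u j refl))))
    (λ _ → ≤-reflexive (trans k≡ (sym (trans (count-here uᵗ j refl) row))))
    where row = row-of-box j j<n (conjugate j (<⇒≤ j<n))

  transpose-involutive : ∀ j → j < n → transpose uᵗ j ≡ u j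
  transpose-involutive j j<n = row-of-box j j<n (conjugate j (<⇒≤ j<n))

  transpose-lattice : Lattice n uᵗ
  transpose-lattice j j≤n l = go (count uᵗ j (2 + l)) refl
    where
    go : ∀ c → count uᵗ j (2 + l) ≡ c → c ≤ count uᵗ j (1 + l)
    go zero    _  = z≤n
    go (suc k) eq = Equivalence.from (conjugate j j≤n k l)
      (<⇒≤ (Equivalence.to (conjugate j j≤n k (suc l)) (≤-reflexive (sym eq))))

  -- Rows do not get longer further down, so a box added in a later row lies weakly to the left, and
  -- one added in the same or an earlier row strictly to the right.
  transpose-≤ : ∀ j → suc j < n → u j < u (suc j) → uᵗ (suc j) ≤ uᵗ j
  transpose-≤ j j<n lt
    rewrite count-there u j (λ e → <⇒≢ lt (sym e)) =
    s≤s (partition-antitone {count u j} (u-lat j (<⇒≤ (<⇒≤ j<n))) (u-pos j (<⇒≤ j<n)) (<⇒≤ lt))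

  transpose-< : ∀ j → suc j < n → u (suc j) ≤ u j → uᵗ j < uᵗ (suc j)
  transpose-< j j<n le = s≤s (subst (_≤ count u (suc j) (u (suc j))) (count-here u j refl)
    (partition-antitone {count u (suc j)} (u-lat (suc j) (<⇒≤ j<n)) (u-pos (suc j) j<n) le))

  transpose-letter⇒ones : ∀ j → j < n → uᵗ j ≤ count u n 1
  transpose-letter⇒ones j j<n = begin
    suc (count u j (u j)) ≡⟨ count-here u j refl ⟨
    count u (suc j) (u j) ≤⟨ partition-antitone {count u (suc j)} (u-lat (suc j) j<n) ≤-refl (u-pos j j<n) ⟩
    count u (suc j) 1     ≤⟨ count-mono u 1 j<n ⟩
    count u n 1           ∎
    where open ≤-Reasoning

ones⇒transpose-letter : ∀ u n m → suc m ≤ count u n 1 → ∃ λ j → j < n × suc m ≤ transpose u j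
ones⇒transpose-letter u n m p =
  let j , j<n , uj≡1 , m≤ = count-last u 1 n m p
  in j , j<n , s≤s (subst (λ z → m ≤ count u j z) (sym uj≡1) m≤)

-- Involutions with transposed tableaux

record InvolutionOn (n : ℕ) (f : ℕ → ℕ) : Set where
  field
    involutive : Involutive f
    bounded    : ∀ i → i < n → f i < n

  injective : ∀ {i j} → f i ≡ f j → i ≡ j
  injective = involutive-injective involutive

  letters-positive : ∀ j → j < n → 1 ≤ hor f n j
  letters-positive j j<n = hor-nonzero {f} involutive (bounded j j<n) (involutive j)

  lattice : Lattice n (hor f n)
  lattice = hor-lattice {f} involutive n n

  decreasing⇒letter : ∀ {m} → Decreasing f n 0 (suc m) → ∃ λ j → j < n × suc m ≤ hor f n j
  decreasing⇒letter c = risingFrom-letter (decreasing⇒risingFrom {f} involutive bounded ≤-refl z≤n c)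

  letter⇒decreasing : ∀ {m} j → j < n → m ≤ hor f n j → Decreasing f n 0 m
  letter⇒decreasing j j<n m≤ = go (hor f n j) refl m≤
    where
    go : ∀ {m} k → hor f n j ≡ k → m ≤ k → Decreasing f n 0 m
    go zero    _  z≤n = []
    go (suc k) eq m≤k = decreasing-drop m≤k
      (risingTo⇒decreasing {f} involutive n (lattice⇒risingTo lattice k j j<n eq))

-- The tableaux of f and g are transposes of each other.
Mirror : ℕ → (f g : ℕ → ℕ) → Set
Mirror n f g = ∀ j → j < n → hor g n j ≡ transpose (hor f n) j

module _ {n f g} (F : InvolutionOn n f) (mirror : Mirror n f g) where
  private module F = InvolutionOn F

  mirror-sym : Mirror n g f
  mirror-sym j j<n = sym (trans (transpose-cong mirror j j<n)
    (transpose-involutive F.letters-positive F.lattice j j<n))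

  module _ (G : InvolutionOn n g) where
    private module G = InvolutionOn G

    mirror-decreasing : ∀ {m} → Decreasing g n 0 (suc m) → Increasing f n n (suc m)
    mirror-decreasing c = let j , j<n , m< = G.decreasing⇒letter c in
      ones⇒increasing {f} F.involutive n n _ (≤-trans (subst (_ ≤_) (mirror j j<n) m<)
        (transpose-letter⇒ones F.letters-positive F.lattice j j<n))

    mirror-increasing : ∀ {m} → Increasing f n n (suc m) → Decreasing g n 0 (suc m)
    mirror-increasing c =
      let j , j<n , m< = ones⇒transpose-letter (hor f n) n _ (increasing⇒ones {f} F.involutive c)
      in G.letter⇒decreasing j j<n (subst (_ ≤_) (sym (mirror j j<n)) m<)

    -- The letters of `g` rise strictly here, which `ascent⇒≥` forbids at an ascent of `g`; by
    -- injectivity a descent remains.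
    mirror-ascent : ∀ j → suc j < n → f j < f (suc j) → g (suc j) < g j
    mirror-ascent j j<n lt = ≤∧≢⇒<
      (≮⇒≥ λ gj<gj+1 → <⇒≱ letters< (ascent⇒≥ {g} G.involutive j gj<gj+1 n))
      (λ e → 1+n≢n (G.injective e))
      where
      letters< : hor g n j < hor g n (suc j)
      letters< rewrite mirror j (<⇒≤ j<n) | mirror (suc j) j<n =
        transpose-< F.letters-positive F.lattice j j<n (ascent⇒≥ {f} F.involutive j lt n)

    mirror-descent : ∀ j → suc j < n → f (suc j) < f j → g j < g (suc j)
    mirror-descent j j<n lt = ≤∧≢⇒<
      (≮⇒≥ λ gj+1<gj → <⇒≱ (descent⇒< {g} G.involutive j gj+1<gj n (G.bounded (suc j) j<n)) letters≥)
      (λ e → 1+n≢n (sym (G.injective e)))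
      where
      letters≥ : hor g n (suc j) ≤ hor g n j
      letters≥ rewrite mirror j (<⇒≤ j<n) | mirror (suc j) j<n =
        transpose-≤ F.letters-positive F.lattice j j<n
          (descent⇒< {f} F.involutive j lt n (F.bounded (suc j) j<n))

mirror-exists : ∀ {n f} → InvolutionOn n f → ∃ λ g → InvolutionOn n g × Mirror n f g
mirror-exists {n} {f} F =
  let g , g-inv , g< , top = growth-surjective n (transpose (hor f n)) (λ _ _ → s≤s z≤n)
                               (transpose-lattice F.letters-positive F.lattice)
  in g , record { involutive = g-inv ; bounded = g< } , top
  where module F = InvolutionOn F

mirror-injective : ∀ {n f₁ f₂ g} → InvolutionOn n f₁ → InvolutionOn n f₂ →
  Mirror n f₁ g → Mirror n f₂ g → ∀ i → i < n → f₂ i ≡ f₁ i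
mirror-injective {n} {f₁} {f₂} F₁ F₂ m₁ m₂ =
  growth-injective F₁.involutive F₂.involutive n F₁.bounded
    (λ j j<n → trans (mirror-sym F₁ m₁ j j<n) (sym (mirror-sym F₂ m₂ j j<n)))
  where
  module F₁ = InvolutionOn F₁
  module F₂ = InvolutionOn F₂

-- Words over Fin n

lookup-unique : ∀ {A : Set} {xs : List A} → Unique xs → ∀ i j → List.lookup xs i ≡ List.lookup xs j → i ≡ j
lookup-unique (_  ∷ _) 0F 0F _ = refl
lookup-unique (x∉ ∷ _) 0F (Fin.suc j) e = contradiction e (All.lookup x∉ (∈-lookup j))
lookup-unique (x∉ ∷ _) (Fin.suc i) 0F e = contradiction (sym e) (All.lookup x∉ (∈-lookup i))
lookup-unique (_  ∷ u) (Fin.suc i) (Fin.suc j) e = cong Fin.suc (lookup-unique u i j e)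

length-≤ : ∀ {A B : Set} {xs : List A} {ys : List B} (R : A → B → Set) → Unique xs →
  (∀ {x} → x ∈ xs → ∃ λ y → y ∈ ys × R x y) →
  (∀ {x x′ y} → x ∈ xs → x′ ∈ xs → R x y → R x′ y → x ≡ x′) → length xs ≤ length ys
length-≤ {xs = xs} {ys} R unique total injective = Fin.injective⇒≤ {f = position} position-injective
  where
  image : ∀ i → ∃ λ y → y ∈ ys × R (List.lookup xs i) y
  image i = total (∈-lookup i)
  position : Fin (length xs) → Fin (length ys)
  position i = Any.index (proj₁ (proj₂ (image i)))
  lookup-position : ∀ i → proj₁ (image i) ≡ List.lookup ys (position i)
  lookup-position i = lookup-index (proj₁ (proj₂ (image i)))
  position-injective : ∀ {i j} → position i ≡ position j → i ≡ j
  position-injective {i} {j} e = lookup-unique unique i j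
    (injective (∈-lookup i) (∈-lookup j) (proj₂ (proj₂ (image i)))
      (subst (R (List.lookup xs j))
        (trans (lookup-position j) (trans (cong (List.lookup ys) (sym e)) (sym (lookup-position i))))
        (proj₂ (proj₂ (image j)))))

card-≤ : ∀ {n k} {P Q : Pred (Word n k) 0ℓ} (P? : Decidable P) (Q? : Decidable Q)
  (R : Word n k → Word n k → Set) →
  (∀ {π} → P π → ∃ λ σ → Q σ × R π σ) →
  (∀ {π π′ σ} → P π → P π′ → R π σ → R π′ σ → π ≡ π′) → card P? ≤ card Q?
card-≤ {n} {k} P? Q? R total injective =
  length-≤ R (filter⁺ P? (words-unique n k))
    (λ π∈ → let σ , Qσ , r = total (proj₂ (∈-filter⁻ P? {xs = words n k} π∈))
            in σ , ∈-filter⁺ Q? (words-complete σ) Qσ , r)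
    (λ π∈ π′∈ → injective (proj₂ (∈-filter⁻ P? {xs = words n k} π∈))
                          (proj₂ (∈-filter⁻ P? {xs = words n k} π′∈)))

-- The identity from `n` on makes the extension of an involution an involution of all naturals.
extend : ∀ {n} → Word n n → ℕ → ℕ
extend {n} π i with i <? n
... | yes i<n = toℕ (lookup π (fromℕ< i<n))
... | no  _   = i

extend-toℕ : ∀ {n} (π : Word n n) a → extend π (toℕ a) ≡ toℕ (lookup π a)
extend-toℕ {n} π a with toℕ a <? n
... | yes a<n = cong (toℕ ∘ lookup π) (Fin.fromℕ<-toℕ a a<n)
... | no  a≮n = contradiction (Fin.toℕ<n a) a≮n

extend-fromℕ< : ∀ {n} (π : Word n n) {i} (i<n : i < n) → extend π i ≡ toℕ (lookup π (fromℕ< i<n))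
extend-fromℕ< π i<n = trans (cong (extend π) (sym (Fin.toℕ-fromℕ< i<n))) (extend-toℕ π (fromℕ< i<n))

extend-involution : ∀ {n} {π : Word n n} → IsInvolution π → InvolutionOn n (extend π)
extend-involution {n} {π} inv = record { involutive = involutive ; bounded = bounded }
  where
  bounded : ∀ i → i < n → extend π i < n
  bounded i i<n = subst (_< n) (sym (extend-fromℕ< π i<n)) (Fin.toℕ<n _)
  outside : ∀ i → i ≮ n → extend π i ≡ i
  outside i i≮n with i <? n
  ... | yes i<n = contradiction i<n i≮n
  ... | no  _   = refl
  involutive : Involutive (extend π)
  involutive i = by-cases (i <? n)
    where
    open ≡-Reasoning
    by-cases : Dec (i < n) → extend π (extend π i) ≡ i
    by-cases (yes i<n) = begin
      extend π (extend π i)                  ≡⟨ cong (extend π) (extend-fromℕ< π i<n) ⟩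
      extend π (toℕ (lookup π (fromℕ< i<n))) ≡⟨ extend-toℕ π _ ⟩
      toℕ (lookup π (lookup π (fromℕ< i<n))) ≡⟨ cong toℕ (inv (fromℕ< i<n)) ⟩
      toℕ (fromℕ< i<n)                       ≡⟨ Fin.toℕ-fromℕ< i<n ⟩
      i                                      ∎
    by-cases (no i≮n) = trans (cong (extend π) (outside i i≮n)) (outside i i≮n)

module _ {n f} (F : InvolutionOn n f) where
  open InvolutionOn F

  restrict : Word n n
  restrict = tabulate λ a → fromℕ< (bounded (toℕ a) (Fin.toℕ<n a))

  toℕ-restrict : ∀ a → toℕ (lookup restrict a) ≡ f (toℕ a)
  toℕ-restrict a = trans (cong toℕ (lookup∘tabulate _ a)) (Fin.toℕ-fromℕ< _)

  restrict-involution : IsInvolution restrict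
  restrict-involution a = Fin.toℕ-injective (begin
    toℕ (lookup restrict (lookup restrict a)) ≡⟨ toℕ-restrict (lookup restrict a) ⟩
    f (toℕ (lookup restrict a))               ≡⟨ cong f (toℕ-restrict a) ⟩
    f (f (toℕ a))                             ≡⟨ involutive (toℕ a) ⟩
    toℕ a                                     ∎)
    where open ≡-Reasoning

  extend-restrict : ∀ i → i < n → extend restrict i ≡ f i
  extend-restrict i i<n =
    trans (extend-fromℕ< restrict i<n) (trans (toℕ-restrict _) (cong f (Fin.toℕ-fromℕ< i<n)))

-- The diagram up to height `n` sees only the first `n` values, so replacing an involution by the
-- extension of its word keeps the top word.
hor-cong : ∀ {n f g} → (∀ i → i < n → f i ≡ g i) → ∀ i → i ≤ n → ∀ j → hor f i j ≡ hor g i j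
ver-cong : ∀ {n f g} → (∀ i → i < n → f i ≡ g i) → ∀ i → i < n → ∀ j → ver f i j ≡ ver g i j
hor-cong eq zero    _   j = refl
hor-cong eq (suc i) i<n j
  rewrite eq i i<n | hor-cong eq i (<⇒≤ i<n) j | ver-cong eq i i<n j = refl
ver-cong eq i i<n zero = refl
ver-cong eq i i<n (suc j)
  rewrite eq i i<n | hor-cong eq i (<⇒≤ i<n) j | ver-cong eq i i<n j = refl

involution⇒permutation : ∀ {n} {π : Word n n} → IsInvolution π → IsPermutation π
involution⇒permutation {π = π} inv =
  (λ {i} {j} e → trans (sym (inv i)) (trans (cong (lookup π) e) (inv j))) ,
  λ i → lookup π i , λ { refl → inv i }

MirrorWords : ∀ {n} → Word n n → Word n n → Set
MirrorWords {n} π σ = Mirror n (extend π) (extend σ)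

mirror-word : ∀ {n} {π : Word n n} → IsInvolution π → ∃ λ σ → IsInvolution σ × MirrorWords π σ
mirror-word {n} {π} inv =
  let g , G , mirror = mirror-exists (extend-involution {π = π} inv) in
  restrict G , restrict-involution G ,
  λ j j<n → trans (hor-cong (extend-restrict G) n ≤-refl j) (mirror j j<n)

mirror-words-injective : ∀ {n} {π π′ σ : Word n n} → IsInvolution π → IsInvolution π′ →
  MirrorWords π σ → MirrorWords π′ σ → π ≡ π′
mirror-words-injective {n} {π} {π′} inv inv′ m m′ = begin
  π                    ≡⟨ tabulate∘lookup π ⟨
  tabulate (lookup π)  ≡⟨ tabulate-cong (Fin.toℕ-injective ∘ same) ⟩
  tabulate (lookup π′) ≡⟨ tabulate∘lookup π′ ⟩
  π′                   ∎
  where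
  open ≡-Reasoning
  same : ∀ a → toℕ (lookup π a) ≡ toℕ (lookup π′ a)
  same a = trans (sym (extend-toℕ π a)) (trans
    (mirror-injective (extend-involution {π = π′} inv′) (extend-involution {π = π} inv) m′ m
      (toℕ a) (Fin.toℕ<n a))
    (extend-toℕ π′ a))

-- Pattern occurrences as monotone sequences of four points

chain₄ : ∀ {A : Set} {_≺_ : A → A → Set} → (∀ {x y z} → x ≺ y → y ≺ z → x ≺ z) →
  (g : Fin 4 → A) → g 0F ≺ g 1F → g 1F ≺ g 2F → g 2F ≺ g 3F → ∀ a b → a Fin.< b → g a ≺ g b
chain₄ tr g p q r 0F 1F _ = p
chain₄ tr g p q r 0F 2F _ = tr p q
chain₄ tr g p q r 0F 3F _ = tr p (tr q r)
chain₄ tr g p q r 1F 2F _ = q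
chain₄ tr g p q r 1F 3F _ = tr q r
chain₄ tr g p q r 2F 3F _ = r
chain₄ tr g p q r 1F 1F (s≤s ())
chain₄ tr g p q r 2F 1F (s≤s ())
chain₄ tr g p q r 3F 1F (s≤s ())
chain₄ tr g p q r 2F 2F (s≤s (s≤s ()))
chain₄ tr g p q r 3F 2F (s≤s (s≤s ()))
chain₄ tr g p q r 3F 3F (s≤s (s≤s (s≤s ())))

reflects : ∀ {m} (g : Fin m → ℕ) → (∀ a b → a Fin.< b → g a < g b) → ∀ a b → g a < g b → a Fin.< b
reflects g mono a b lt with Fin.<-cmp a b
... | tri< a<b _ _  = a<b
... | tri≈ _ refl _ = contradiction lt (<-irrefl refl)
... | tri> _ _ b<a  = contradiction lt (<-asym (mono b a b<a))

reflects-flip : ∀ {m} (g : Fin m → ℕ) → (∀ a b → a Fin.< b → g b < g a) → ∀ a b → g a < g b → b Fin.< a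
reflects-flip g anti a b lt with Fin.<-cmp a b
... | tri< a<b _ _  = contradiction lt (<-asym (anti a b a<b))
... | tri≈ _ refl _ = contradiction lt (<-irrefl refl)
... | tri> _ _ b<a  = b<a

lookup-[1234] : ∀ a → lookup [1234] a ≡ a
lookup-[1234] = from-yes (Fin.all? λ a → lookup [1234] a Fin.≟ a)

lookup-[4321] : ∀ a b → lookup [4321] a Fin.< lookup [4321] b ⇔ b Fin.< a
lookup-[4321] = from-yes (Fin.all? λ a → Fin.all? λ b →
  (lookup [4321] a Fin.<? lookup [4321] b) ⇔-dec (b Fin.<? a))

module _ {n} (π : Word n n) where

  contains⇒increasing : Contains [1234] π → Increasing (extend π) n n 4
  contains⇒increasing (ι , ι-mono , order) =
    ((([] ∷⟨ rows 0F 1F ≤-refl , values 0F 1F ≤-refl ⟩) ∷⟨ rows 1F 2F ≤-refl , values 1F 2F ≤-refl ⟩)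
      ∷⟨ rows 2F 3F ≤-refl , values 2F 3F ≤-refl ⟩)
      ∷⟨ Fin.toℕ<n (lookup ι 3F) , subst (_< n) (sym (extend-toℕ π (lookup ι 3F))) (Fin.toℕ<n _) ⟩
    where
    rows : ∀ a b → a Fin.< b → toℕ (lookup ι a) < toℕ (lookup ι b)
    rows = ι-mono
    values : ∀ a b → lookup [1234] a Fin.< lookup [1234] b →
             extend π (toℕ (lookup ι a)) < extend π (toℕ (lookup ι b))
    values a b τ< = subst₂ _<_ (sym (extend-toℕ π _)) (sym (extend-toℕ π _))
                      (Equivalence.to (order a b) τ<)

  contains⇒decreasing : Contains [4321] π → Decreasing (extend π) n 0 4
  contains⇒decreasing (ι , ι-mono , order) =
    ((([] ∷⟨ rows 0F 1F ≤-refl , values 1F 0F ≤-refl ⟩) ∷⟨ rows 1F 2F ≤-refl , values 2F 1F ≤-refl ⟩)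
      ∷⟨ rows 2F 3F ≤-refl , values 3F 2F ≤-refl ⟩)
      ∷⟨ Fin.toℕ<n (lookup ι 3F) , z≤n ⟩
    where
    rows : ∀ a b → a Fin.< b → toℕ (lookup ι a) < toℕ (lookup ι b)
    rows = ι-mono
    values : ∀ a b → lookup [4321] a Fin.< lookup [4321] b →
             extend π (toℕ (lookup ι a)) < extend π (toℕ (lookup ι b))
    values a b τ< = subst₂ _<_ (sym (extend-toℕ π _)) (sym (extend-toℕ π _))
                      (Equivalence.to (order a b) τ<)

  module _ {i₀ i₁ i₂ i₃} (i₀<i₁ : i₀ < i₁) (i₁<i₂ : i₁ < i₂) (i₂<i₃ : i₂ < i₃) (i₃<n : i₃ < n) where

    i₂<n = <-trans i₂<i₃ i₃<n
    i₁<n = <-trans i₁<i₂ i₂<n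
    i₀<n = <-trans i₀<i₁ i₁<n

    positions : Word n 4
    positions = fromℕ< i₀<n ∷ fromℕ< i₁<n ∷ fromℕ< i₂<n ∷ fromℕ< i₃<n ∷ []

    positions-mono : ∀ a b → a Fin.< b → lookup positions a Fin.< lookup positions b
    positions-mono = chain₄ {_≺_ = _<_} <-trans (toℕ ∘ lookup positions) 
      (lift i₀<n i₁<n i₀<i₁) (lift i₁<n i₂<n i₁<i₂) (lift i₂<n i₃<n i₂<i₃)
      where
      lift : ∀ {i j} (i<n : i < n) (j<n : j < n) → i < j → fromℕ< i<n Fin.< fromℕ< j<n
      lift i<n j<n = subst₂ _<_ (sym (Fin.toℕ-fromℕ< i<n)) (sym (Fin.toℕ-fromℕ< j<n))

    value : Fin 4 → ℕ
    value = toℕ ∘ lookup π ∘ lookup positions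

    lift-value : ∀ {i j} (i<n : i < n) (j<n : j < n) → extend π i < extend π j →
           toℕ (lookup π (fromℕ< i<n)) < toℕ (lookup π (fromℕ< j<n))
    lift-value i<n j<n = subst₂ _<_ (extend-fromℕ< π i<n) (extend-fromℕ< π j<n)

    increasing-occurrence : extend π i₀ < extend π i₁ → extend π i₁ < extend π i₂ →
      extend π i₂ < extend π i₃ → IsOccurrence [1234] π positions
    increasing-occurrence p q r = positions-mono , λ a b → mk⇔
      (λ τ< → mono a b (subst₂ Fin._<_ (lookup-[1234] a) (lookup-[1234] b) τ<))
      (λ v< → subst₂ Fin._<_ (sym (lookup-[1234] a)) (sym (lookup-[1234] b)) (reflects value mono a b v<))
      where
      mono : ∀ a b → a Fin.< b → value a < value b
      mono = chain₄ {_≺_ = _<_} <-trans value (lift-value i₀<n i₁<n p) (lift-value i₁<n i₂<n q) (lift-value i₂<n i₃<n r)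

    decreasing-occurrence : extend π i₁ < extend π i₀ → extend π i₂ < extend π i₁ →
      extend π i₃ < extend π i₂ → IsOccurrence [4321] π positions
    decreasing-occurrence p q r = positions-mono , λ a b → mk⇔
      (λ τ< → anti b a (Equivalence.to (lookup-[4321] a b) τ<))
      (λ v< → Equivalence.from (lookup-[4321] a b) (reflects-flip value anti a b v<))
      where
      anti : ∀ a b → a Fin.< b → value b < value a
      anti = chain₄ {_≺_ = _>_} (λ x y → <-trans y x) value (lift-value i₁<n i₀<n p) (lift-value i₂<n i₁<n q) (lift-value i₃<n i₂<n r)

  increasing⇒contains : Increasing (extend π) n n 4 → Contains [1234] π
  increasing⇒contains (((([] ∷⟨ i₀<i₁ , p ⟩) ∷⟨ i₁<i₂ , q ⟩) ∷⟨ i₂<i₃ , r ⟩) ∷⟨ i₃<n , _ ⟩) =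
    positions i₀<i₁ i₁<i₂ i₂<i₃ i₃<n , increasing-occurrence i₀<i₁ i₁<i₂ i₂<i₃ i₃<n p q r

  decreasing⇒contains : Decreasing (extend π) n 0 4 → Contains [4321] π
  decreasing⇒contains (((([] ∷⟨ i₀<i₁ , p ⟩) ∷⟨ i₁<i₂ , q ⟩) ∷⟨ i₂<i₃ , r ⟩) ∷⟨ i₃<n , _ ⟩) =
    positions i₀<i₁ i₁<i₂ i₂<i₃ i₃<n , decreasing-occurrence i₀<i₁ i₁<i₂ i₂<i₃ i₃<n p q r

-- Transfer of the properties and comparison of cardinalities

Transfers : ∀ {n} → Pred (Word n n) 0ℓ → Pred (Word n n) 0ℓ → Set
Transfers P Q = ∀ π σ → IsInvolution π → IsInvolution σ → MirrorWords π σ → P π → Q σ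

avoids-[1234]⇒[4321] : ∀ n → Transfers {n} (Avoids [1234]) (Avoids [4321])
avoids-[1234]⇒[4321] n π σ π-inv σ-inv mirror avoids c =
  avoids (increasing⇒contains π (mirror-decreasing F mirror G (contains⇒decreasing σ c)))
  where
  F = extend-involution {π = π} π-inv
  G = extend-involution {π = σ} σ-inv

avoids-[4321]⇒[1234] : ∀ n → Transfers {n} (Avoids [4321]) (Avoids [1234])
avoids-[4321]⇒[1234] n π σ π-inv σ-inv mirror avoids c =
  avoids (decreasing⇒contains π (mirror-increasing G (mirror-sym F mirror) F (contains⇒increasing σ c)))
  where
  F = extend-involution {π = π} π-inv
  G = extend-involution {π = σ} σ-inv

adjacent-flip : ∀ {n} {π σ : Word n n} → IsInvolution π → IsInvolution σ → MirrorWords π σ →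
  ∀ i j → toℕ j ≡ suc (toℕ i) → lookup π i Fin.< lookup π j ⇔ lookup σ j Fin.< lookup σ i
adjacent-flip {n} {π} {σ} π-inv σ-inv mirror i j j≡ = mk⇔
  (λ lt → value-< σ (subst (λ z → extend σ z < extend σ (toℕ i)) (sym j≡)
    (mirror-ascent F mirror G (toℕ i) j<n
      (subst (λ z → extend π (toℕ i) < extend π z) j≡ (extend-< π lt)))))
  (λ lt → value-< π (subst (λ z → extend π (toℕ i) < extend π z) (sym j≡)
    (mirror-descent G (mirror-sym F mirror) F (toℕ i) j<n
      (subst (λ z → extend σ z < extend σ (toℕ i)) j≡ (extend-< σ lt)))))
  where
  F = extend-involution {π = π} π-inv
  G = extend-involution {π = σ} σ-inv
  j<n : suc (toℕ i) < n
  j<n = subst (_< n) j≡ (Fin.toℕ<n j)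
  value-< : ∀ (ρ : Word n n) {a b} → extend ρ (toℕ a) < extend ρ (toℕ b) → lookup ρ a Fin.< lookup ρ b
  value-< ρ = subst₂ _<_ (extend-toℕ ρ _) (extend-toℕ ρ _)
  extend-< : ∀ (ρ : Word n n) {a b} → lookup ρ a Fin.< lookup ρ b → extend ρ (toℕ a) < extend ρ (toℕ b)
  extend-< ρ = subst₂ _<_ (sym (extend-toℕ ρ _)) (sym (extend-toℕ ρ _))

alternating⇒reverseAlternating : ∀ n → Transfers {n} Alternating ReverseAlternating
alternating⇒reverseAlternating n π σ π-inv σ-inv mirror alt i j j≡ =
  mk⇔ (to (alt i j j≡) ∘ from flip) (to flip ∘ from (alt i j j≡))
  where
  open Equivalence
  flip = adjacent-flip {π = π} {σ} π-inv σ-inv mirror i j j≡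

reverseAlternating⇒alternating : ∀ n → Transfers {n} ReverseAlternating Alternating
reverseAlternating⇒alternating n π σ π-inv σ-inv mirror alt i j j≡ =
  mk⇔ (to (alt i j j≡) ∘ to flip) (from flip ∘ from (alt i j j≡))
  where
  open Equivalence
  flip = adjacent-flip {π = σ} {π} σ-inv π-inv
           (mirror-sym (extend-involution {π = π} π-inv) mirror) i j j≡

-- Transposition is its own inverse, so this one inequality, applied with the roles exchanged, also
-- gives the opposite one; the theorem uses it four times.
mirror-card-≤ : ∀ n {Z Z′ A A′ : Pred (Word n n) 0ℓ}
  (Z? : Decidable Z) (Z′? : Decidable Z′) (A? : Decidable A) (A′? : Decidable A′) →
  Transfers Z Z′ → Transfers A A′ →
  card ((λ π → isPermutation? π ×-dec isInvolution? π ×-dec Z? π) ∩? A?) ≤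
  card ((λ π → isPermutation? π ×-dec isInvolution? π ×-dec Z′? π) ∩? A′?)
mirror-card-≤ n Z? Z′? A? A′? Z⇒Z′ A⇒A′ =
  card-≤ ((λ π → isPermutation? π ×-dec isInvolution? π ×-dec Z? π) ∩? A?)
         ((λ π → isPermutation? π ×-dec isInvolution? π ×-dec Z′? π) ∩? A′?)
    MirrorWords
    (λ {π} ((_ , inv , Zπ) , Aπ) →
      let σ , inv′ , mirror = mirror-word {π = π} inv in
      σ , ((involution⇒permutation {π = σ} inv′ , inv′ , Z⇒Z′ π σ inv inv′ mirror Zπ) ,
           A⇒A′ π σ inv inv′ mirror Aπ) , mirror)
    (λ {π} {π′} {σ} ((_ , inv , _) , _) ((_ , inv′ , _) , _) →
      mirror-words-injective {π = π} {π′} {σ} inv inv′)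

theorem5p5 : ∀ (n : ℕ) → 1 ≤ n →
    (card (AI? n ∩? avoids? [1234]) ≡ card (RAI? n ∩? avoids? [4321])) ×
    (card (RAI? n ∩? avoids? [1234]) ≡ card (AI? n ∩? avoids? [4321]))
theorem5p5 n _ =
  ≤-antisym
    (mirror-card-≤ n alternating? reverseAlternating? (avoids? [1234]) (avoids? [4321])
      (alternating⇒reverseAlternating n) (avoids-[1234]⇒[4321] n))
    (mirror-card-≤ n reverseAlternating? alternating? (avoids? [4321]) (avoids? [1234])
      (reverseAlternating⇒alternating n) (avoids-[4321]⇒[1234] n)) ,
  ≤-antisym
    (mirror-card-≤ n reverseAlternating? alternating? (avoids? [1234]) (avoids? [4321])
      (reverseAlternating⇒alternating n) (avoids-[1234]⇒[4321] n))
    (mirror-card-≤ n alternating? reverseAlternating? (avoids? [4321]) (avoids? [1234])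
      (alternating⇒reverseAlternating n) (avoids-[4321]⇒[1234] n))
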